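{- For integers $m,k\ge 0$ let $P_{m,k}=J([m]\times[k])$. Then, as formal power series in $x,y$, \[\sum_{m=0}^\infty \sum_{k=0}^\infty d(P_{m,k})\,x^m y^k = \frac{2xy}{(x^2 - 2xy + y^2 - 2x - 2y + 1)^2}.\]
   Context: For a finite connected graph $G=(V,E)$, with $d(p,q)$ the graph distance, the Wiener index is $d(G)=\sum_{(p,q)\in V\times V} d(p,q)$ (sum over ordered pairs). For a finite poset $P$, $d(P)$ denotes the Wiener index of the Hasse diagram of $P$ (vertices the elements of $P$, edges the cover relations). $J(P)$ is the lattice of order ideals of $P$ ordered by inclusion; $[m]=\{1,\dots,m\}$ is a chain and $[m]\times[k]$ has the componentwise order ($[0]$ is empty, so $J([0]\times[k])$ has one element). -}

module Defs where

open import Data.Bool using (Bool; true; false; not; _∧_; _∨_)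
open import Data.Nat using (ℕ; zero; suc; _≤_; _∸_) renaming (_≤ᵇ_ to _≤ᵇℕ_)
open import Data.Integer using (ℤ; +_; -_) renaming (_+_ to _+ℤ_; _*_ to _*ℤ_)
open import Data.Fin using (Fin; toℕ)
open import Data.List using (List; []; _∷_; map; concatMap; filter; foldr; allFin; upTo)
open import Data.Vec using (Vec; []; _∷_; lookup)
open import Data.Product using (Σ; _×_; ∃)
open import Data.Empty using (⊥)
open import Relation.Binary.PropositionalEquality using (_≡_; _≢_)
open import Relation.Nullary.Decidable using (does)
open import Data.Bool.Properties using () renaming (_≟_ to _≟B_)

-- Subsets of [m] × [k]  (elements (i , j) with i : Fin m, j : Fin k,
-- standing for (i+1 , j+1)); a subset is an m × k Boolean matrix.

Mat : ℕ → ℕ → Set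
Mat m k = Vec (Vec Bool k) m

_∋_,_ : ∀ {m k} → Mat m k → Fin m → Fin k → Bool
I ∋ i , j = lookup (lookup I i) j

allVecsOf : {A : Set} → List A → (n : ℕ) → List (Vec A n)
allVecsOf xs zero = [] ∷ []
allVecsOf xs (suc n) = concatMap (λ x → map (x ∷_) (allVecsOf xs n)) xs

allMats : (m k : ℕ) → List (Mat m k)
allMats m k = allVecsOf (allVecsOf (true ∷ false ∷ []) k) m

leqᵇ : ∀ {m k} → Fin m → Fin k → Fin m → Fin k → Bool
leqᵇ i' j' i j = (toℕ i' ≤ᵇℕ toℕ i) ∧ (toℕ j' ≤ᵇℕ toℕ j)

allᵇ : {A : Set} → (A → Bool) → List A → Bool
allᵇ p = foldr (λ a b → p a ∧ b) true

isIdeal : ∀ {m k} → Mat m k → Bool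
isIdeal {m} {k} I =
  allᵇ (λ i → allᵇ (λ j → not (I ∋ i , j) ∨
    allᵇ (λ i' → allᵇ (λ j' → not (leqᵇ i' j' i j) ∨ (I ∋ i' , j')) (allFin k)) (allFin m))
    (allFin k)) (allFin m)

IsIdeal : ∀ {m k} → Mat m k → Set
IsIdeal I = isIdeal I ≡ true

ideals : (m k : ℕ) → List (Mat m k)
ideals m k = filter (λ I → isIdeal I ≟B true) (allMats m k)

_⊆_ : ∀ {m k} → Mat m k → Mat m k → Set
_⊆_ {m} {k} I J = (i : Fin m) (j : Fin k) → (I ∋ i , j) ≡ true → (J ∋ i , j) ≡ true

_⊂_ : ∀ {m k} → Mat m k → Mat m k → Set
I ⊂ J = (I ⊆ J) × (I ≢ J)

Covers : ∀ {m k} → Mat m k → Mat m k → Set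
Covers {m} {k} I J =
  IsIdeal I × IsIdeal J × (I ⊂ J) ×
  ((K : Mat m k) → IsIdeal K → I ⊂ K → K ⊂ J → ⊥)

data Adj {m k : ℕ} (I J : Mat m k) : Set where
  up   : Covers I J → Adj I J
  down : Covers J I → Adj I J

data Walk {m k : ℕ} : Mat m k → Mat m k → ℕ → Set where
  nil  : ∀ {I} → IsIdeal I → Walk I I zero
  step : ∀ {I J L n} → Adj I J → Walk J L n → Walk I L (suc n)

IsDist : ∀ {m k} → Mat m k → Mat m k → ℕ → Set
IsDist I J n = Walk I J n × ((n' : ℕ) → Walk I J n' → n ≤ n')

sumℕ : List ℕ → ℕ
sumℕ = foldr Data.Nat._+_ 0

WienerIndexIs : (m k : ℕ) → ℕ → Set
WienerIndexIs m k w =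
  Σ (Mat m k → Mat m k → ℕ) λ D →
    ((I J : Mat m k) → IsIdeal I → IsIdeal J → IsDist I J (D I J)) ×
    (w ≡ sumℕ (concatMap (λ I → map (λ J → D I J) (ideals m k)) (ideals m k)))

-- Formal power series in x, y over ℤ as coefficient functions ℕ → ℕ → ℤ.

sumℤ : List ℤ → ℤ
sumℤ = foldr _+ℤ_ (+ 0)

conv : (ℕ → ℕ → ℤ) → (ℕ → ℕ → ℤ) → ℕ → ℕ → ℤ
conv f g m k =
  sumℤ (map (λ i → sumℤ (map (λ j → f i j *ℤ g (m ∸ i) (k ∸ j)) (upTo (suc k))))
    (upTo (suc m)))

basePoly : ℕ → ℕ → ℤ
basePoly 0 0 = + 1
basePoly 1 0 = - (+ 2)
basePoly 0 1 = - (+ 2)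
basePoly 2 0 = + 1
basePoly 1 1 = - (+ 2)
basePoly 0 2 = + 1
basePoly _ _ = + 0

denom : ℕ → ℕ → ℤ
denom = conv basePoly basePoly

numer : ℕ → ℕ → ℤ
numer 1 1 = + 2
numer _ _ = + 0

{-# OPTIONS --safe #-}
module Submission where

-- An ideal of [m] × [k] is a weakly decreasing sequence of m row lengths at most k, and the
-- graph distance of two ideals is the ℓ¹-distance of these sequences: a cover changes one row
-- length by one, and a step towards the other ideal always exists.
--
-- Let c m k count the ideals, let S m k l be the sum of the distances over pairs of sequences
-- bounded by k and by l, and put Wₕ = Σ S m k (k+h) xᵐ yᵏ, Gₕ = Σ c m k · c m (k+h) xᵐ yᵏ,
-- L = 1 + y − x.  Splitting off the first entries gives L Wₕ = y Wₕ₊₁ + Wₕ₋₁ + h x Gₕ, with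
-- L W₀ = 2 y W₁, and Pascal's rule gives L Gₕ = y Gₕ₊₁ + Gₕ₋₁, with L G₀ = 2 y G₁ + 1.
-- With B = L² − 4 y, the base of the denominator, and Dₕ = L Gₕ − 2 y Gₕ₊₁, the sequence
--   2 B² Wₕ = 4 x y Dₕ + x B (h L Gₕ + h² Dₕ)
-- solves the recurrence, whose solution is unique.  Since D₀ = 1, B² W₀ = 2 x y.

open import Defs
open import Algebra.Bundles using (CommutativeRing; RawRing)
import Algebra.Properties.CommutativeSemigroup
import Algebra.Properties.Ring
import Algebra.Solver.Ring
open import Algebra.Solver.Ring.AlmostCommutativeRing
  using (fromCommutativeRing; _-Raw-AlmostCommutative⟶_; -raw-almostCommutative⟶)
open import Algebra.Structures using (IsCommutativeRing)
open import Data.Bool.Base using (Bool; true; false; not; _∧_; _∨_; if_then_else_)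
open import Data.Bool.Properties using (T-≡) renaming (_≟_ to _≟ᵇ_)
open import Data.Fin.Base using (Fin; zero; suc; toℕ; fromℕ<)
open import Data.Fin.Properties using (toℕ-fromℕ<; toℕ<n)
open import Data.Integer using (+_)
open import Data.Integer.Base as ℤ using (ℤ; -[1+_]; +-*-rawRing)
import Data.Integer.Properties as ℤₚ
import Data.Integer.Tactic.RingSolver as ℤ-Solver
open import Data.List.Base
  using (List; []; _∷_; _++_; map; concatMap; filter; tabulate; applyUpTo; upTo)
open import Data.List.Properties using (map-++; map-∘; map-cong; map-applyUpTo)
import Data.Maybe.Base as Maybe
open import Data.Nat.Base as ℕ using (ℕ; zero; suc; ∣_-_∣; _∸_)
open import Data.Nat.ListAction.Properties using (sum-++)
import Data.Nat.Properties as ℕₚ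
import Data.Nat.Tactic.RingSolver as ℕ-Solver
open import Data.Product.Base using (Σ; ∃-syntax; _×_; _,_; proj₁; proj₂)
open import Data.Sum.Base using (_⊎_; inj₁; inj₂)
open import Data.Vec.Base as Vec using (Vec; []; _∷_; lookup)
open import Data.Vec.Properties using (lookup-map; ≡-dec)
open import Data.Vec.Relation.Binary.Pointwise.Inductive as Pointwise using (Pointwise; []; _∷_)
open import Function.Base using (_∘_; id)
open import Function.Bundles using (Equivalence)
open import Level using (0ℓ)
open import Relation.Binary.PropositionalEquality as ≡ using (_≡_; _≢_)
import Relation.Binary.Reasoning.Setoid
open import Relation.Nullary using (yes; no; contradiction)
open import Relation.Nullary.Decidable using (dec⇒maybe)

-- The ring of formal power series over a commutative ring.

module PowerSeries (R : CommutativeRing 0ℓ 0ℓ) where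
  open CommutativeRing R hiding (zero)
  open Relation.Binary.Reasoning.Setoid setoid
  open Algebra.Properties.CommutativeSemigroup +-commutativeSemigroup
    using () renaming (interchange to +-interchange)
  open Algebra.Properties.Ring ring using (-0#≈0#)

  Series : Set
  Series = ℕ → Carrier

  infix  4 _≐_
  infixl 6 _⊕_
  infixl 7 _⊛_

  _≐_ : Series → Series → Set
  f ≐ g = ∀ n → f n ≈ g n

  -- The Cauchy product peels off the constant term of the left factor, so the ring laws follow by
  -- induction on the degree, with no finite sums to reindex.
  _⊕_ _⊛_ : Series → Series → Series
  (f ⊕ g) n = f n + g n
  (f ⊛ g) zero    = f 0 * g 0
  (f ⊛ g) (suc n) = f 0 * g (suc n) + (f ∘ suc ⊛ g) n

  const : Carrier → Series
  const a zero    = a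
  const a (suc _) = 0#

  shift : Series → Series
  shift f zero    = 0#
  shift f (suc n) = f n

  ⊛-cong : ∀ {f f′ g g′} → f ≐ f′ → g ≐ g′ → f ⊛ g ≐ f′ ⊛ g′
  ⊛-cong p q zero    = *-cong (p 0) (q 0)
  ⊛-cong p q (suc n) = +-cong (*-cong (p 0) (q (suc n))) (⊛-cong (p ∘ suc) q n)

  ⊛-distribʳ : ∀ h f g → (f ⊕ g) ⊛ h ≐ f ⊛ h ⊕ g ⊛ h
  ⊛-distribʳ h f g zero    = distribʳ _ _ _
  ⊛-distribʳ h f g (suc n) = begin
    (f 0 + g 0) * h (suc n) + ((f ⊕ g) ∘ suc ⊛ h) n
      ≈⟨ +-cong (distribʳ _ _ _) (⊛-distribʳ h (f ∘ suc) (g ∘ suc) n) ⟩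
    (f 0 * h (suc n) + g 0 * h (suc n)) + ((f ∘ suc ⊛ h) n + (g ∘ suc ⊛ h) n)
      ≈⟨ +-interchange _ _ _ _ ⟩
    (f ⊛ h ⊕ g ⊛ h) (suc n) ∎

  ⊛-scaleˡ : ∀ a f g → (λ n → a * f n) ⊛ g ≐ (λ n → a * (f ⊛ g) n)
  ⊛-scaleˡ a f g zero    = *-assoc _ _ _
  ⊛-scaleˡ a f g (suc n) = begin
    a * f 0 * g (suc n) + ((λ n → a * f (suc n)) ⊛ g) n
      ≈⟨ +-cong (*-assoc _ _ _) (⊛-scaleˡ a (f ∘ suc) g n) ⟩
    a * (f 0 * g (suc n)) + a * (f ∘ suc ⊛ g) n ≈⟨ distribˡ _ _ _ ⟨
    a * (f ⊛ g) (suc n) ∎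

  ⊛-zeroˡ : ∀ g → (λ _ → 0#) ⊛ g ≐ (λ _ → 0#)
  ⊛-zeroˡ g zero    = zeroˡ _
  ⊛-zeroˡ g (suc n) = trans (+-cong (zeroˡ _) (⊛-zeroˡ g n)) (+-identityˡ _)

  const-⊛ : ∀ a f → const a ⊛ f ≐ (λ n → a * f n)
  const-⊛ a f zero    = refl
  const-⊛ a f (suc n) = trans (+-congˡ (⊛-zeroˡ f n)) (+-identityʳ _)

  -- The mirror image of the defining recursion, peeling a term off the right factor; commutativity
  -- exchanges the two forms.
  ⊛-suc : ∀ f g n → (f ⊛ g) (suc n) ≈ (f ⊛ g ∘ suc) n + f (suc n) * g 0
  ⊛-suc f g zero    = refl
  ⊛-suc f g (suc n) = begin
    f 0 * g (suc (suc n)) + (f ∘ suc ⊛ g) (suc n)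
      ≈⟨ +-congˡ (⊛-suc (f ∘ suc) g n) ⟩
    f 0 * g (suc (suc n)) + ((f ∘ suc ⊛ g ∘ suc) n + f (suc (suc n)) * g 0)
      ≈⟨ +-assoc _ _ _ ⟨
    (f ⊛ g ∘ suc) (suc n) + f (suc (suc n)) * g 0 ∎

  ⊛-comm : ∀ f g → f ⊛ g ≐ g ⊛ f
  ⊛-comm f g zero    = *-comm _ _
  ⊛-comm f g (suc n) = begin
    f 0 * g (suc n) + (f ∘ suc ⊛ g) n ≈⟨ +-cong (*-comm _ _) (⊛-comm (f ∘ suc) g n) ⟩
    g (suc n) * f 0 + (g ⊛ f ∘ suc) n ≈⟨ +-comm _ _ ⟩
    (g ⊛ f ∘ suc) n + g (suc n) * f 0 ≈⟨ ⊛-suc g f n ⟨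
    (g ⊛ f) (suc n) ∎

  ⊛-assoc : ∀ f g h → (f ⊛ g) ⊛ h ≐ f ⊛ (g ⊛ h)
  ⊛-assoc f g h zero    = *-assoc _ _ _
  ⊛-assoc f g h (suc n) = begin
    -- By definition the tail of `f ⊛ g` is `f 0` times the tail of `g` plus `f ∘ suc ⊛ g`, so
    -- distributivity splits its product with `h`.
    f 0 * g 0 * h (suc n) + (((λ i → f 0 * g (suc i)) ⊕ (f ∘ suc ⊛ g)) ⊛ h) n
      ≈⟨ +-cong (*-assoc _ _ _) (⊛-distribʳ h (λ i → f 0 * g (suc i)) (f ∘ suc ⊛ g) n) ⟩
    f 0 * (g 0 * h (suc n)) + (((λ i → f 0 * g (suc i)) ⊛ h) n + ((f ∘ suc ⊛ g) ⊛ h) n)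
      ≈⟨ +-congˡ (+-cong (⊛-scaleˡ (f 0) (g ∘ suc) h n) (⊛-assoc (f ∘ suc) g h n)) ⟩
    f 0 * (g 0 * h (suc n)) + (f 0 * (g ∘ suc ⊛ h) n + (f ∘ suc ⊛ (g ⊛ h)) n)
      ≈⟨ +-assoc _ _ _ ⟨
    f 0 * (g 0 * h (suc n)) + f 0 * (g ∘ suc ⊛ h) n + (f ∘ suc ⊛ (g ⊛ h)) n
      ≈⟨ +-congʳ (distribˡ _ _ _) ⟨
    (f ⊛ (g ⊛ h)) (suc n) ∎

  ⊛-identityˡ : ∀ f → const 1# ⊛ f ≐ f
  ⊛-identityˡ f n = trans (const-⊛ 1# f n) (*-identityˡ _)

  shift-⊛ : ∀ f g → shift f ⊛ g ≐ shift (f ⊛ g)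
  shift-⊛ f g zero    = zeroˡ _
  shift-⊛ f g (suc n) = trans (+-congʳ (zeroˡ _)) (+-identityˡ _)

  variable-⊛ : ∀ f → shift (const 1#) ⊛ f ≐ shift f
  variable-⊛ f zero    = shift-⊛ (const 1#) f zero
  variable-⊛ f (suc n) = trans (shift-⊛ (const 1#) f (suc n)) (⊛-identityˡ f n)

  ⊛-isCommutativeRing : IsCommutativeRing _≐_ _⊕_ _⊛_ (λ f n → - f n) (λ _ → 0#) (const 1#)
  ⊛-isCommutativeRing = record
    { isRing = record
      { +-isAbelianGroup = record
        { isGroup = record
          { isMonoid = record
            { isSemigroup = record
              { isMagma = record
                { isEquivalence = record
                  { refl  = λ _ → refl
                  ; sym   = λ p n → sym (p n)
                  ; trans = λ p q n → trans (p n) (q n)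
                  }
                ; ∙-cong = λ p q n → +-cong (p n) (q n)
                }
              ; assoc = λ _ _ _ _ → +-assoc _ _ _
              }
            ; identity = (λ _ _ → +-identityˡ _) , (λ _ _ → +-identityʳ _)
            }
          ; inverse = (λ _ _ → -‿inverseˡ _) , (λ _ _ → -‿inverseʳ _)
          ; ⁻¹-cong = λ p n → -‿cong (p n)
          }
        ; comm = λ _ _ _ → +-comm _ _
        }
      ; *-cong     = ⊛-cong
      ; *-assoc    = ⊛-assoc
      ; *-identity = ⊛-identityˡ
                   , λ f n → trans (⊛-comm f (const 1#) n) (⊛-identityˡ f n)
      ; distrib    = (λ f g h n → trans (⊛-comm f (g ⊕ h) n)
                       (trans (⊛-distribʳ f g h n) (+-cong (⊛-comm g f n) (⊛-comm h f n))))
                   , ⊛-distribʳ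
      }
    ; *-comm = ⊛-comm
    }

  seriesRing : CommutativeRing 0ℓ 0ℓ
  seriesRing = record { isCommutativeRing = ⊛-isCommutativeRing }

  -- Carries the coefficients of the ring solver from `R` to series over `R`; applied twice it
  -- serves series in two variables.
  const-morphism : ∀ {C : RawRing 0ℓ 0ℓ} →
    C -Raw-AlmostCommutative⟶ fromCommutativeRing R →
    C -Raw-AlmostCommutative⟶ fromCommutativeRing seriesRing
  const-morphism φ = record
    { ⟦_⟧    = λ a → const ⟦ a ⟧
    ; +-homo = λ { a b zero → +-homo a b ; _ _ (suc _) → sym (+-identityˡ _) }
    ; *-homo = λ { a b zero → *-homo a b
                 ; a b (suc n) → sym (trans (const-⊛ ⟦ a ⟧ (const ⟦ b ⟧) (suc n)) (zeroʳ _)) }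
    ; -‿homo = λ { a zero → -‿homo a ; _ (suc _) → sym -0#≈0# }
    ; 0-homo = λ { zero → 0-homo ; (suc _) → refl }
    ; 1-homo = λ { zero → 1-homo ; (suc _) → refl }
    }
    where open _-Raw-AlmostCommutative⟶_ φ

-- Solving the recurrence in h by a closed form.

module Recurrences
  (R : CommutativeRing 0ℓ 0ℓ)
  (φ : +-*-rawRing -Raw-AlmostCommutative⟶ fromCommutativeRing R)
  where
  open CommutativeRing R hiding (zero; -_)
  open _-Raw-AlmostCommutative⟶_ φ
  open Relation.Binary.Reasoning.Setoid setoid
  open Algebra.Solver.Ring +-*-rawRing (fromCommutativeRing R) φ
    (λ a b → Maybe.map (λ a≡b → reflexive (≡.cong ⟦_⟧ a≡b)) (dec⇒maybe (a ℤₚ.≟ b)))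
    using (Polynomial; solve; _:=_; _:+_; _:*_; con)

  module Solution
    (L x y : Carrier) (G W : ℕ → Carrier)
    (G-zero : L * G 0 ≈ ⟦ + 2 ⟧ * (y * G 1) + 1#)
    (G-suc  : ∀ h → L * G (suc h) ≈ y * G (suc (suc h)) + G h)
    (W-zero : L * W 0 ≈ ⟦ + 2 ⟧ * (y * W 1))
    (W-suc  : ∀ h → L * W (suc h) ≈ y * W (suc (suc h)) + W h + x * (⟦ + suc h ⟧ * G (suc h)))
    where

    -- The discriminant of y ρ² - L ρ + 1, the characteristic polynomial of the homogeneous
    -- recurrence.
    B : Carrier
    B = L * L + ⟦ -[1+ 3 ] ⟧ * y

    -- If y ρ² − L ρ + 1 = 0 and G h = ρʰ / √B, then D h = ρʰ.
    D : ℕ → Carrier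
    D h = L * G h + ⟦ -[1+ 1 ] ⟧ * (y * G (suc h))

    -- The arguments stand for h, `G h` and `D h`. Keeping them independent lets each value of `P`
    -- be rewritten in two consecutive values of `G`, after which the recurrence is a polynomial
    -- identity.
    closed : (η g d : Carrier) → Carrier
    closed η g d = ⟦ + 4 ⟧ * (x * y) * d + x * B * (L * η * g + η * η * d)

    -- P h is 2 B² W h as found by variation of constants from the homogeneous solution ρʰ.
    P E : ℕ → Carrier
    P h = closed ⟦ + h ⟧ (G h) (D h)
    E h = ⟦ + 2 ⟧ * (B * (B * W h)) + ⟦ -[1+ 0 ] ⟧ * P h

    closed-cong : ∀ {η η′ g g′ d d′} → η ≈ η′ → g ≈ g′ → d ≈ d′ → closed η g d ≈ closed η′ g′ d′
    closed-cong p q r = +-cong (*-congˡ r)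
      (*-congˡ (+-cong (*-cong (*-congˡ p) q) (*-cong (*-cong p p) r)))

    private
      Bₚ : ∀ {n} → Polynomial n → Polynomial n → Polynomial n
      Bₚ L y = L :* L :+ con -[1+ 3 ] :* y

      closedₚ : ∀ {n} (L x y η g d : Polynomial n) → Polynomial n
      closedₚ L x y η g d = con (+ 4) :* (x :* y) :* d :+ x :* Bₚ L y :* (L :* η :* g :+ η :* η :* d)

    G-prev : ∀ h → G h ≈ L * G (suc h) + ⟦ -[1+ 0 ] ⟧ * (y * G (suc (suc h)))
    G-prev h = begin
      G h ≈⟨ solve 2 (λ g b → g := b :+ g :+ con -[1+ 0 ] :* b) refl (G h) (y * G (suc (suc h))) ⟩
      y * G (suc (suc h)) + G h + ⟦ -[1+ 0 ] ⟧ * (y * G (suc (suc h))) ≈⟨ +-congʳ (G-suc h) ⟨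
      L * G (suc h) + ⟦ -[1+ 0 ] ⟧ * (y * G (suc (suc h))) ∎

    -- The recurrence trades `G (suc (suc h))` for `G h`, so that `D` can be expressed in the same
    -- two values of `G` as its predecessor.
    D-suc : ∀ h → D (suc h) ≈ ⟦ + 2 ⟧ * G h + ⟦ -[1+ 0 ] ⟧ * (L * G (suc h))
    D-suc h = begin
      L * G (suc h) + ⟦ -[1+ 1 ] ⟧ * (y * G (suc (suc h)))
        ≈⟨ solve 2 (λ l b → l :+ con -[1+ 1 ] :* b
              := con (+ 2) :* (l :+ con -[1+ 0 ] :* b) :+ con -[1+ 0 ] :* l) refl _ _ ⟩
      ⟦ + 2 ⟧ * (L * G (suc h) + ⟦ -[1+ 0 ] ⟧ * (y * G (suc (suc h)))) + ⟦ -[1+ 0 ] ⟧ * (L * G (suc h))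
        ≈⟨ +-congʳ (*-congˡ (G-prev h)) ⟨
      ⟦ + 2 ⟧ * G h + ⟦ -[1+ 0 ] ⟧ * (L * G (suc h)) ∎

    -- The inhomogeneous term 1 of `G-zero` is what survives; it normalises the whole solution.
    D-zero : D 0 ≈ 1#
    D-zero = begin
      L * G 0 + ⟦ -[1+ 1 ] ⟧ * (y * G 1) ≈⟨ +-congʳ G-zero ⟩
      ⟦ + 2 ⟧ * (y * G 1) + 1# + ⟦ -[1+ 1 ] ⟧ * (y * G 1)
        ≈⟨ solve 2 (λ u b → con (+ 2) :* b :+ u :+ con -[1+ 1 ] :* b := u) refl _ _ ⟩
      1# ∎

    P-zero : P 0 ≈ ⟦ + 4 ⟧ * (x * y) * D 0
    P-zero = solve 5 (λ L x y g d →
      closedₚ L x y (con (+ 0)) g d := con (+ 4) :* (x :* y) :* d) refl L x y (G 0) (D 0)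

    -- Once `D-suc` is applied, both sides are polynomials in `G 0` and `G 1` and agree as such.
    P-zero-step : L * P 0 ≈ ⟦ + 2 ⟧ * (y * P 1)
    P-zero-step = begin
      L * P 0
        ≈⟨ solve 5 (λ L x y a b →
             L :* closedₚ L x y (con (+ 0)) a (L :* a :+ con -[1+ 1 ] :* (y :* b))
             := con (+ 2) :* (y :* closedₚ L x y (con (+ 1)) b (con (+ 2) :* a :+ con -[1+ 0 ] :* (L :* b))))
           refl L x y (G 0) (G 1) ⟩
      ⟦ + 2 ⟧ * (y * closed ⟦ + 1 ⟧ (G 1) (⟦ + 2 ⟧ * G 0 + ⟦ -[1+ 0 ] ⟧ * (L * G 1)))
        ≈⟨ *-congˡ (*-congˡ (closed-cong refl refl (D-suc 0))) ⟨
      ⟦ + 2 ⟧ * (y * P 1) ∎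

    -- Everything is reduced to `a` and `b`: `G-prev` gives `G h` and `D-suc` gives
    -- `D (suc (suc h))`. What remains is a polynomial identity with h as an indeterminate η, for
    -- which `+-homo` splits the images of h + 1 and h + 2.
    P-suc-step : ∀ h → L * P (suc h) ≈ y * P (suc (suc h)) + P h
                       + ⟦ + 2 ⟧ * (B * (B * (x * (⟦ + suc h ⟧ * G (suc h)))))
    P-suc-step h = begin
      L * P (suc h)
        ≈⟨ *-congˡ (closed-cong (+-homo (+ 1) (+ h)) refl refl) ⟩
      L * closed (⟦ + 1 ⟧ + η) a (L * a + ⟦ -[1+ 1 ] ⟧ * (y * b))
        ≈⟨ solve 6 (λ L x y η a b →
             let g = L :* a :+ con -[1+ 0 ] :* (y :* b) in
             L :* closedₚ L x y (con (+ 1) :+ η) a (L :* a :+ con -[1+ 1 ] :* (y :* b))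
             := y :* closedₚ L x y (con (+ 2) :+ η) b (con (+ 2) :* a :+ con -[1+ 0 ] :* (L :* b))
             :+ closedₚ L x y η g (L :* g :+ con -[1+ 1 ] :* (y :* a))
             :+ con (+ 2) :* (Bₚ L y :* (Bₚ L y :* (x :* ((con (+ 1) :+ η) :* a)))))
           refl L x y η a b ⟩
      y * closed (⟦ + 2 ⟧ + η) b (⟦ + 2 ⟧ * a + ⟦ -[1+ 0 ] ⟧ * (L * b))
        + closed η g (L * g + ⟦ -[1+ 1 ] ⟧ * (y * a))
        + ⟦ + 2 ⟧ * (B * (B * (x * ((⟦ + 1 ⟧ + η) * a))))
        ≈⟨ +-cong
             (+-cong (*-congˡ (closed-cong (+-homo (+ 2) (+ h)) refl (D-suc (suc h))))
                     (closed-cong refl (G-prev h) (+-congʳ (*-congˡ (G-prev h)))))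
             (*-congˡ (*-congˡ (*-congˡ (*-congˡ (*-congʳ (+-homo (+ 1) (+ h))))))) ⟨
      y * P (suc (suc h)) + P h + ⟦ + 2 ⟧ * (B * (B * (x * (⟦ + suc h ⟧ * G (suc h))))) ∎
      where
      η = ⟦ + h ⟧
      a = G (suc h)
      b = G (suc (suc h))
      g = L * a + ⟦ -[1+ 0 ] ⟧ * (y * b)

    E-zero : L * E 0 ≈ ⟦ + 2 ⟧ * (y * E 1)
    E-zero = begin
      L * E 0
        ≈⟨ solve 5 (λ L B w p n → L :* (con (+ 2) :* (B :* (B :* w)) :+ n :* p)
             := con (+ 2) :* (B :* (B :* (L :* w))) :+ n :* (L :* p)) refl L B (W 0) (P 0) ⟦ -[1+ 0 ] ⟧ ⟩
      ⟦ + 2 ⟧ * (B * (B * (L * W 0))) + ⟦ -[1+ 0 ] ⟧ * (L * P 0)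
        ≈⟨ +-cong (*-congˡ (*-congˡ (*-congˡ W-zero))) (*-congˡ P-zero-step) ⟩
      ⟦ + 2 ⟧ * (B * (B * (⟦ + 2 ⟧ * (y * W 1)))) + ⟦ -[1+ 0 ] ⟧ * (⟦ + 2 ⟧ * (y * P 1))
        ≈⟨ solve 5 (λ y B w p n → con (+ 2) :* (B :* (B :* (con (+ 2) :* (y :* w)))) :+ n :* (con (+ 2) :* (y :* p))
             := con (+ 2) :* (y :* (con (+ 2) :* (B :* (B :* w)) :+ n :* p))) refl y B (W 1) (P 1) ⟦ -[1+ 0 ] ⟧ ⟩
      ⟦ + 2 ⟧ * (y * E 1) ∎

    -- 2 B² W and `P` obey the recurrence with the same source term, so their difference obeys the
    -- homogeneous one.
    E-suc : ∀ h → L * E (suc h) ≈ y * E (suc (suc h)) + E h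
    E-suc h = begin
      L * E (suc h)
        ≈⟨ solve 5 (λ L B w p n → L :* (con (+ 2) :* (B :* (B :* w)) :+ n :* p)
             := con (+ 2) :* (B :* (B :* (L :* w))) :+ n :* (L :* p)) refl L B (W (suc h)) (P (suc h)) ⟦ -[1+ 0 ] ⟧ ⟩
      ⟦ + 2 ⟧ * (B * (B * (L * W (suc h)))) + ⟦ -[1+ 0 ] ⟧ * (L * P (suc h))
        ≈⟨ +-cong (*-congˡ (*-congˡ (*-congˡ (W-suc h)))) (*-congˡ (P-suc-step h)) ⟩
      ⟦ + 2 ⟧ * (B * (B * (y * W (suc (suc h)) + W h + s)))
        + ⟦ -[1+ 0 ] ⟧ * (y * P (suc (suc h)) + P h + ⟦ + 2 ⟧ * (B * (B * s)))
        ≈⟨ solve 7 (λ y B w w′ p p′ s →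
             con (+ 2) :* (B :* (B :* (y :* w′ :+ w :+ s)))
               :+ con -[1+ 0 ] :* (y :* p′ :+ p :+ con (+ 2) :* (B :* (B :* s)))
             := y :* (con (+ 2) :* (B :* (B :* w′)) :+ con -[1+ 0 ] :* p′)
               :+ (con (+ 2) :* (B :* (B :* w)) :+ con -[1+ 0 ] :* p))
           refl y B (W h) (W (suc (suc h))) (P h) (P (suc (suc h))) s ⟩
      y * E (suc (suc h)) + E h ∎
      where s = x * (⟦ + suc h ⟧ * G (suc h))

    -- In a general ring the homogeneous recurrence may have nonzero solutions, so the vanishing of
    -- `E 0` is assumed here; `Uniqueness` proves it for power series.
    solution : E 0 ≈ 0# → ⟦ + 2 ⟧ * (B * (B * W 0)) ≈ ⟦ + 4 ⟧ * (x * y)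
    solution E0≈0 = begin
      ⟦ + 2 ⟧ * (B * (B * W 0))
        ≈⟨ solve 2 (λ v p → v := v :+ con -[1+ 0 ] :* p :+ p) refl _ (P 0) ⟩
      E 0 + P 0                    ≈⟨ +-cong E0≈0 P-zero ⟩
      0# + ⟦ + 4 ⟧ * (x * y) * D 0 ≈⟨ +-identityˡ _ ⟩
      ⟦ + 4 ⟧ * (x * y) * D 0      ≈⟨ *-congˡ D-zero ⟩
      ⟦ + 4 ⟧ * (x * y) * 1#       ≈⟨ *-identityʳ _ ⟩
      ⟦ + 4 ⟧ * (x * y) ∎

-- Counting bounded decreasing sequences and summing their distances.

module Counting where
  open import Data.Nat.Base using (_+_; _*_; _≤_; z≤n)
  open ℕₚ
  open ℕ-Solver using (solve-∀)
  open Algebra.Properties.CommutativeSemigroup +-commutativeSemigroup using (interchange)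
  open ≡ using (refl; sym; trans; cong; cong₂; module ≡-Reasoning)
  open ≡-Reasoning

  -- The bound is inclusive because a row length bounded by n takes n + 1 values; Pascal's rule for
  -- `chains` then holds by definition.
  psum : (ℕ → ℕ) → ℕ → ℕ
  psum f zero    = f 0
  psum f (suc n) = psum f n + f (suc n)

  psum-cong : ∀ {f g} → (∀ i → f i ≡ g i) → ∀ n → psum f n ≡ psum g n
  psum-cong p zero    = p 0
  psum-cong p (suc n) = cong₂ _+_ (psum-cong p n) (p (suc n))

  psum-+ : ∀ f g n → psum (λ i → f i + g i) n ≡ psum f n + psum g n
  psum-+ f g zero    = refl
  psum-+ f g (suc n) = trans (cong (_+ (f (suc n) + g (suc n))) (psum-+ f g n))
                             (interchange (psum f n) (psum g n) (f (suc n)) (g (suc n)))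

  psum-swap : ∀ (F : ℕ → ℕ → ℕ) k l →
    psum (λ i → psum (F i) l) k ≡ psum (λ j → psum (λ i → F i j) k) l
  psum-swap F zero    l = refl
  psum-swap F (suc k) l = trans (cong (_+ psum (F (suc k)) l) (psum-swap F k l))
                                (sym (psum-+ (λ j → psum (λ i → F i j) k) (F (suc k)) l))

  -- Inclusion and exclusion on a rectangle with its last row and column: only the corner cell is
  -- left over.
  psum²-suc-suc : ∀ (F : ℕ → ℕ → ℕ) k l →
    let S = λ k l → psum (λ i → psum (F i) l) k in
    S (suc k) (suc l) + S k l ≡ S k (suc l) + S (suc k) l + F (suc k) (suc l)
  psum²-suc-suc F k l = rearrange (psum (λ i → psum (F i) (suc l)) k) (psum (F (suc k)) l)
                                  (F (suc k) (suc l)) (psum (λ i → psum (F i) l) k)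
    where
    rearrange : ∀ a b c d → a + (b + c) + d ≡ a + (d + b) + c
    rearrange = solve-∀

  psum-cong-≤ : ∀ {f g} n → (∀ {i} → i ≤ n → f i ≡ g i) → psum f n ≡ psum g n
  psum-cong-≤ zero    p = p z≤n
  psum-cong-≤ (suc n) p = cong₂ _+_ (psum-cong-≤ n (λ i≤n → p (m≤n⇒m≤1+n i≤n))) (p ≤-refl)

  psum-head : ∀ f n → psum f (suc n) ≡ psum (f ∘ suc) n + f 0
  psum-head f zero    = +-comm (f 0) (f 1)
  psum-head f (suc n) = begin
    psum f (suc n) + f (suc (suc n))           ≡⟨ cong (_+ f (suc (suc n))) (psum-head f n) ⟩
    psum (f ∘ suc) n + f 0 + f (suc (suc n))   ≡⟨ swap (psum (f ∘ suc) n) (f 0) (f (suc (suc n))) ⟩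
    psum (f ∘ suc) n + f (suc (suc n)) + f 0   ∎
    where
    swap : ∀ a b c → a + b + c ≡ a + c + b
    swap = solve-∀

  psum-* : ∀ c f n → psum (λ i → c * f i) n ≡ c * psum f n
  psum-* c f zero    = refl
  psum-* c f (suc n) = trans (cong (_+ c * f (suc n)) (psum-* c f n)) (sym (*-distribˡ-+ c (psum f n) _))

  -- The number of weakly decreasing sequences of length m with entries at most k.
  chains : ℕ → ℕ → ℕ
  chains zero    k = 1
  chains (suc m) k = psum (chains m) k

  -- The sum of the ℓ¹-distances of all pairs of such sequences, with entries at most k and
  -- at most l respectively; the recursion splits off the first entries i and j.
  spread : ℕ → ℕ → ℕ → ℕ
  spread-summand : ℕ → ℕ → ℕ → ℕ
  spread zero    k l = 0
  spread (suc m) k l = psum (λ i → psum (spread-summand m i) l) k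
  spread-summand m i j = ∣ i - j ∣ * (chains m i * chains m j) + spread m i j

  spread-sym : ∀ m k l → spread m k l ≡ spread m l k
  spread-summand-sym : ∀ m i j → spread-summand m i j ≡ spread-summand m j i
  spread-sym zero    k l = refl
  spread-sym (suc m) k l = trans (psum-swap (spread-summand m) k l)
    (psum-cong (λ j → psum-cong (λ i → spread-summand-sym m i j) k) l)
  spread-summand-sym m i j = cong₂ _+_
    (cong₂ _*_ (∣-∣-comm i j) (*-comm (chains m i) (chains m j))) (spread-sym m i j)

  ∣m-n+m∣≡n : ∀ m n → ∣ m - n + m ∣ ≡ n
  ∣m-n+m∣≡n m n = trans (cong ∣ m -_∣ (+-comm n m)) (∣m-m+n∣≡n m n)

  spread-summand-zero : ∀ m k → spread-summand m k k ≡ spread m k k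
  spread-summand-zero m k = cong (λ d → d * (chains m k * chains m k) + spread m k k) (∣n-n∣≡0 k)

-- Bivariate generating functions and the final identity.

module GeneratingFunction where
  open Counting
  open ≡ using (refl; sym; trans; cong; cong₂; subst; module ≡-Reasoning)

  -- Series in x are taken over series in y, so that `f m k` is the coefficient of xᵐ yᵏ, as in
  -- `conv`.
  module Y = PowerSeries ℤₚ.+-*-commutativeRing
  module X = PowerSeries Y.seriesRing

  ℤ⟦x,y⟧-morphism : +-*-rawRing -Raw-AlmostCommutative⟶ fromCommutativeRing X.seriesRing
  ℤ⟦x,y⟧-morphism = X.const-morphism (Y.const-morphism
    (-raw-almostCommutative⟶ (fromCommutativeRing ℤₚ.+-*-commutativeRing)))

  open CommutativeRing X.seriesRing using (_≈_; _+_; _*_; 1#)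
    renaming (Carrier to ℤ⟦x,y⟧; refl to ≈-refl; trans to ≈-trans; *-cong to ≈-*-cong; *-assoc to ≈-*-assoc)
  open _-Raw-AlmostCommutative⟶_ ℤ⟦x,y⟧-morphism using (⟦_⟧)

  x y L : ℤ⟦x,y⟧
  x = X.shift (X.const (Y.const (+ 1)))
  y = X.const (Y.shift (Y.const (+ 1)))
  L = 1# + y + ⟦ -[1+ 0 ] ⟧ * x

  x-coeff : ∀ f m k → (x * f) m k ≡ X.shift f m k
  x-coeff f m = X.variable-⊛ f m

  y-coeff : ∀ f m k → (y * f) m k ≡ Y.shift (f m) k
  y-coeff f m k = trans (X.const-⊛ (Y.shift (Y.const (+ 1))) f m k) (Y.variable-⊛ (f m) k)

  scalar-coeff : ∀ a f m k → (⟦ a ⟧ * f) m k ≡ a ℤ.* f m k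
  scalar-coeff a f m k = trans (X.const-⊛ (Y.const a) f m k) (Y.const-⊛ a (f m) k)

  L-coeff : ∀ f m k → (L * f) m k ≡ f m k ℤ.+ Y.shift (f m) k ℤ.+ -[1+ 0 ] ℤ.* X.shift f m k
  L-coeff f m k = begin
    (L * f) m k ≡⟨ X.⊛-distribʳ f (1# + y) (⟦ -[1+ 0 ] ⟧ * x) m k ⟩
    ((1# + y) * f) m k ℤ.+ (⟦ -[1+ 0 ] ⟧ * x * f) m k
      ≡⟨ cong₂ ℤ._+_ (X.⊛-distribʳ f 1# y m k) (≈-*-assoc ⟦ -[1+ 0 ] ⟧ x f m k) ⟩
    (1# * f) m k ℤ.+ (y * f) m k ℤ.+ (⟦ -[1+ 0 ] ⟧ * (x * f)) m k
      ≡⟨ cong₂ ℤ._+_ (cong₂ ℤ._+_ (X.⊛-identityˡ f m k) (y-coeff f m k))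
           (trans (scalar-coeff -[1+ 0 ] (x * f) m k) (cong (-[1+ 0 ] ℤ.*_) (x-coeff f m k))) ⟩
    f m k ℤ.+ Y.shift (f m) k ℤ.+ -[1+ 0 ] ℤ.* X.shift f m k ∎
    where open ≡-Reasoning

  -- Bringing -x f to the other side leaves a condition without subtraction, which for counting
  -- series is an identity of natural numbers.
  L*≈ : ∀ f {g} → (∀ m k → f m k ℤ.+ Y.shift (f m) k ≡ g m k ℤ.+ X.shift f m k) → L * f ≈ g
  L*≈ f {g} p m k = begin
    (L * f) m k ≡⟨ L-coeff f m k ⟩
    f m k ℤ.+ Y.shift (f m) k ℤ.+ -[1+ 0 ] ℤ.* X.shift f m k
      ≡⟨ cong (ℤ._+ -[1+ 0 ] ℤ.* X.shift f m k) (p m k) ⟩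
    g m k ℤ.+ X.shift f m k ℤ.+ -[1+ 0 ] ℤ.* X.shift f m k ≡⟨ cancel (g m k) (X.shift f m k) ⟩
    g m k ∎
    where
    open ≡-Reasoning
    cancel : ∀ a b → a ℤ.+ b ℤ.+ -[1+ 0 ] ℤ.* b ≡ a
    cancel = ℤ-Solver.solve-∀

  -- Both sides peel off the term i = 0, and `suc n ∸ suc i` reduces to `n ∸ i`.
  sum-applyUpTo : ∀ (f g : ℕ → ℤ) n →
    sumℤ (applyUpTo (λ i → f i ℤ.* g (n ∸ i)) (suc n)) ≡ (f Y.⊛ g) n
  sum-applyUpTo f g zero    = ℤₚ.+-identityʳ _
  sum-applyUpTo f g (suc n) = cong (λ s → f 0 ℤ.* g (suc n) ℤ.+ s) (sum-applyUpTo (f ∘ suc) g n)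

  sum-applyUpTo₂ : ∀ (f g : ℤ⟦x,y⟧) m k →
    sumℤ (applyUpTo (λ i → (f i Y.⊛ g (m ∸ i)) k) (suc m)) ≡ (f * g) m k
  sum-applyUpTo₂ f g zero    k = ℤₚ.+-identityʳ _
  sum-applyUpTo₂ f g (suc m) k = cong (λ s → (f 0 Y.⊛ g (suc m)) k ℤ.+ s) (sum-applyUpTo₂ (f ∘ suc) g m k)

  conv≈* : ∀ f g → conv f g ≈ f * g
  conv≈* f g m k = begin
    conv f g m k
      ≡⟨ cong sumℤ (map-cong (λ i → trans
           (cong sumℤ (map-applyUpTo id (λ j → f i j ℤ.* g (m ∸ i) (k ∸ j)) (suc k)))
           (sum-applyUpTo (f i) (g (m ∸ i)) k)) (upTo (suc m))) ⟩
    sumℤ (map (λ i → (f i Y.⊛ g (m ∸ i)) k) (upTo (suc m)))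
      ≡⟨ cong sumℤ (map-applyUpTo id (λ i → (f i Y.⊛ g (m ∸ i)) k) (suc m)) ⟩
    sumℤ (applyUpTo (λ i → (f i Y.⊛ g (m ∸ i)) k) (suc m)) ≡⟨ sum-applyUpTo₂ f g m k ⟩
    (f * g) m k ∎
    where open ≡-Reasoning

  module Uniqueness
    (E : ℕ → ℤ⟦x,y⟧)
    (E-zero : L * E 0 ≈ ⟦ + 2 ⟧ * (y * E 1))
    (E-suc  : ∀ h → L * E (suc h) ≈ y * E (suc (suc h)) + E h)
    where
    open ≡-Reasoning

    -- L has constant term 1, and its other terms reach only the two neighbouring coefficients,
    -- which vanish by hypothesis.
    leading-coeff : ∀ f m k → X.shift f m k ≡ + 0 → Y.shift (f m) k ≡ + 0 → f m k ≡ (L * f) m k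
    leading-coeff f m k p q = sym (begin
      (L * f) m k ≡⟨ L-coeff f m k ⟩
      f m k ℤ.+ Y.shift (f m) k ℤ.+ -[1+ 0 ] ℤ.* X.shift f m k
        ≡⟨ cong₂ (λ a b → f m k ℤ.+ a ℤ.+ -[1+ 0 ] ℤ.* b) q p ⟩
      f m k ℤ.+ + 0 ℤ.+ + 0 ≡⟨ ℤₚ.+-identityʳ _ ⟩
      f m k ℤ.+ + 0         ≡⟨ ℤₚ.+-identityʳ _ ⟩
      f m k ∎)

    -- Induction on h at one fixed coefficient. A multiple of y contributes only an earlier
    -- coefficient, zero for every index, so `E 0` vanishes and `E (suc h)` inherits this from
    -- `E h`.
    vanish-step : ∀ m k → (∀ h → X.shift (E h) m k ≡ + 0) → (∀ h → Y.shift (E h m) k ≡ + 0) →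
                  ∀ h → E h m k ≡ + 0
    vanish-step m k p q zero = begin
      E 0 m k                     ≡⟨ leading-coeff (E 0) m k (p 0) (q 0) ⟩
      (L * E 0) m k               ≡⟨ E-zero m k ⟩
      (⟦ + 2 ⟧ * (y * E 1)) m k   ≡⟨ scalar-coeff (+ 2) (y * E 1) m k ⟩
      + 2 ℤ.* (y * E 1) m k       ≡⟨ cong (+ 2 ℤ.*_) (trans (y-coeff (E 1) m k) (q 1)) ⟩
      + 0 ∎
    vanish-step m k p q (suc h) = begin
      E (suc h) m k               ≡⟨ leading-coeff (E (suc h)) m k (p (suc h)) (q (suc h)) ⟩
      (L * E (suc h)) m k         ≡⟨ E-suc h m k ⟩
      (y * E (suc (suc h))) m k ℤ.+ E h m k
        ≡⟨ cong₂ ℤ._+_ (trans (y-coeff (E (suc (suc h))) m k) (q (suc (suc h)))) (vanish-step m k p q h) ⟩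
      + 0 ∎

    vanish : ∀ m k h → E h m k ≡ + 0
    vanish zero    zero    = vanish-step 0 0 (λ _ → refl) (λ _ → refl)
    vanish zero    (suc k) = vanish-step 0 (suc k) (λ _ → refl) (vanish 0 k)
    vanish (suc m) zero    = vanish-step (suc m) 0 (vanish m 0) (λ _ → refl)
    vanish (suc m) (suc k) = vanish-step (suc m) (suc k) (vanish m (suc k)) (vanish (suc m) k)

  -- L as a table whose entries compute, so that the coefficients of L² - 4 y can be checked case by
  -- case.
  ℓ : ℤ⟦x,y⟧
  ℓ 0 0 = + 1
  ℓ 0 1 = + 1
  ℓ 1 0 = -[1+ 0 ]
  ℓ _ _ = + 0

  L≈ℓ : L ≈ ℓ
  L≈ℓ m k = trans (cong (λ s → (1# + y) m k ℤ.+ s) (scalar-coeff -[1+ 0 ] x m k)) (table m k)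
    where
    table : ∀ m k → (1# + y) m k ℤ.+ -[1+ 0 ] ℤ.* x m k ≡ ℓ m k
    table 0 0 = refl
    table 0 1 = refl
    table 0 (suc (suc _)) = refl
    table 1 0 = refl
    table 1 (suc k) = refl
    table (suc (suc _)) _ = refl

  basePoly≈ : basePoly ≈ L * L + ⟦ -[1+ 3 ] ⟧ * y
  basePoly≈ m k = sym (trans
    (cong₂ ℤ._+_
      -- Only the right factor becomes the table; multiplication by the left one is the local rule
      -- `L-coeff`, so no convolution is evaluated.
      (trans (≈-*-cong {L} {L} (≈-refl {L}) L≈ℓ m k) (L-coeff ℓ m k))
      (scalar-coeff -[1+ 3 ] y m k))
    (table m k))
    where
    table : ∀ m k → ℓ m k ℤ.+ Y.shift (ℓ m) k ℤ.+ -[1+ 0 ] ℤ.* X.shift ℓ m k ℤ.+ -[1+ 3 ] ℤ.* y m k ≡ basePoly m k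
    table 0 0 = refl
    table 0 1 = refl
    table 0 2 = refl
    table 0 (suc (suc (suc _))) = refl
    table 1 0 = refl
    table 1 1 = refl
    table 1 (suc (suc _)) = refl
    table 2 0 = refl
    table 2 (suc _) = refl
    table (suc (suc (suc _))) 0 = refl
    table (suc (suc (suc _))) (suc _) = refl

  numer≈ : ⟦ + 4 ⟧ * (x * y) ≈ λ m k → + 2 ℤ.* numer m k
  numer≈ m k = trans (scalar-coeff (+ 4) (x * y) m k)
    (trans (cong (+ 4 ℤ.*_) (x-coeff y m k)) (table m k))
    where
    table : ∀ m k → + 4 ℤ.* X.shift y m k ≡ + 2 ℤ.* numer m k
    table 0 0 = refl
    table 0 (suc _) = refl
    table 1 0 = refl
    table 1 1 = refl
    table 1 (suc (suc _)) = refl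
    table (suc (suc _)) _ = refl

  -- Fixing the difference h of the two bounds turns the recursions for products of chain
  -- counts and for spread into linear recurrences in h with constant coefficients.
  G W : ℕ → ℤ⟦x,y⟧
  G h m k = + (chains m k ℕ.* chains m (h ℕ.+ k))
  W h m k = + spread m k (h ℕ.+ k)

  -- With p = `chains (suc m) k` and q = `chains m (suc k)`, Pascal's rule gives p + q for the next
  -- count, and (p + q)² + p² = 2 p (p + q) + q². The 1 accounts for the coefficient at m = k = 0.
  G-zero : L * G 0 ≈ ⟦ + 2 ⟧ * (y * G 1) + 1#
  G-zero = L*≈ (G 0) λ m k → trans (coeffs m k)
    (cong (λ c → c ℤ.+ 1# m k ℤ.+ X.shift (G 0) m k)
      (sym (trans (scalar-coeff (+ 2) (y * G 1) m k) (cong (+ 2 ℤ.*_) (y-coeff (G 1) m k)))))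
    where
    pascal : ∀ p q → (p ℕ.+ q) ℕ.* (p ℕ.+ q) ℕ.+ p ℕ.* p ≡ 2 ℕ.* (p ℕ.* (p ℕ.+ q)) ℕ.+ 0 ℕ.+ q ℕ.* q
    pascal = ℕ-Solver.solve-∀
    coeffs : ∀ m k → G 0 m k ℤ.+ Y.shift (G 0 m) k
           ≡ + 2 ℤ.* Y.shift (G 1 m) k ℤ.+ 1# m k ℤ.+ X.shift (G 0) m k
    coeffs zero    zero    = refl
    coeffs zero    (suc k) = refl
    coeffs (suc m) zero    = cong +_ (ℕₚ.+-identityʳ _)
    coeffs (suc m) (suc k) = trans (cong +_ (pascal (chains (suc m) k) (chains m (suc k))))
      (cong (λ c → c ℤ.+ + 0 ℤ.+ G 0 m (suc k)) (ℤₚ.pos-* 2 (G' m k)))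
      where G' = λ m k → chains (suc m) k ℕ.* chains (suc m) (suc k)

  -- The bilinear version of the identity behind `G-zero`: p and q belong to the bound k, r and s to
  -- the bound larger by h + 1.
  G-suc : ∀ h → L * G (suc h) ≈ y * G (suc (suc h)) + G h
  G-suc h = L*≈ (G (suc h)) λ m k → trans (coeffs m k)
    (cong (λ c → c ℤ.+ G h m k ℤ.+ X.shift (G (suc h)) m k) (sym (y-coeff (G (suc (suc h))) m k)))
    where
    pascal : ∀ p q r s → (p ℕ.+ q) ℕ.* (r ℕ.+ s) ℕ.+ p ℕ.* r
                       ≡ p ℕ.* (r ℕ.+ s) ℕ.+ (p ℕ.+ q) ℕ.* r ℕ.+ q ℕ.* s
    pascal = ℕ-Solver.solve-∀
    coeffs : ∀ m k → G (suc h) m k ℤ.+ Y.shift (G (suc h) m) k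
           ≡ Y.shift (G (suc (suc h)) m) k ℤ.+ G h m k ℤ.+ X.shift (G (suc h)) m k
    coeffs zero    zero    = refl
    coeffs zero    (suc k) = refl
    coeffs (suc m) zero    = cong +_ (edge (chains m 0) (chains (suc m) (h ℕ.+ 0)) (chains m (suc (h ℕ.+ 0))))
      where
      edge : ∀ p r s → p ℕ.* (r ℕ.+ s) ℕ.+ 0 ≡ 0 ℕ.+ p ℕ.* r ℕ.+ p ℕ.* s
      edge = ℕ-Solver.solve-∀
    coeffs (suc m) (suc k) rewrite ℕₚ.+-suc h k = cong +_
      (pascal (chains (suc m) k) (chains m (suc k)) (chains (suc m) (suc (h ℕ.+ k))) (chains m (suc (suc (h ℕ.+ k)))))

  -- On the diagonal the corner of the square has difference zero, and the two overlapping
  -- rectangles agree by symmetry, whence the factor 2.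
  W-zero : L * W 0 ≈ ⟦ + 2 ⟧ * (y * W 1)
  W-zero = L*≈ (W 0) λ m k → trans (coeffs m k)
    (cong (ℤ._+ X.shift (W 0) m k)
      (sym (trans (scalar-coeff (+ 2) (y * W 1) m k) (cong (+ 2 ℤ.*_) (y-coeff (W 1) m k)))))
    where
    coeffs : ∀ m k → W 0 m k ℤ.+ Y.shift (W 0 m) k ≡ + 2 ℤ.* Y.shift (W 1 m) k ℤ.+ X.shift (W 0) m k
    coeffs zero    zero    = refl
    coeffs zero    (suc k) = refl
    coeffs (suc m) zero    = cong +_ (ℕₚ.+-identityʳ _)
    coeffs (suc m) (suc k) = trans (cong +_ (begin
      spread (suc m) (suc k) (suc k) ℕ.+ spread (suc m) k k
        ≡⟨ psum²-suc-suc (spread-summand m) k k ⟩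
      spread (suc m) k (suc k) ℕ.+ spread (suc m) (suc k) k ℕ.+ spread-summand m (suc k) (suc k)
        ≡⟨ cong₂ (λ a b → spread (suc m) k (suc k) ℕ.+ a ℕ.+ b)
             (trans (spread-sym (suc m) (suc k) k) (sym (ℕₚ.+-identityʳ _))) (spread-summand-zero m (suc k)) ⟩
      2 ℕ.* spread (suc m) k (suc k) ℕ.+ spread m (suc k) (suc k) ∎))
      (cong (ℤ._+ + spread m (suc k) (suc k)) (ℤₚ.pos-* 2 (spread (suc m) k (suc k))))
      where open ≡-Reasoning

  -- At the corner of the rectangle the first entries differ by h + 1. Counted over all pairs of
  -- tails this is the source term, and the distances of the tails give x W.
  W-suc : ∀ h → L * W (suc h) ≈ y * W (suc (suc h)) + W h + x * (⟦ + suc h ⟧ * G (suc h))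
  W-suc h = L*≈ (W (suc h)) λ m k → trans (coeffs m k)
    (cong (ℤ._+ X.shift (W (suc h)) m k) (sym (cong₂ (λ a b → a ℤ.+ W h m k ℤ.+ b)
      (y-coeff (W (suc (suc h))) m k) (source m k))))
    where
    hG : ℤ⟦x,y⟧
    hG m k = + (suc h ℕ.* (chains m k ℕ.* chains m (suc h ℕ.+ k)))
    source : ∀ m k → (x * (⟦ + suc h ⟧ * G (suc h))) m k ≡ X.shift hG m k
    source zero    k = x-coeff (⟦ + suc h ⟧ * G (suc h)) zero k
    source (suc m) k = trans (x-coeff (⟦ + suc h ⟧ * G (suc h)) (suc m) k)
      (trans (scalar-coeff (+ suc h) (G (suc h)) m k) (sym (ℤₚ.pos-* (suc h) (chains m k ℕ.* chains m (suc h ℕ.+ k)))))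
    summand : ∀ m k → spread-summand m k (suc h ℕ.+ k)
            ≡ suc h ℕ.* (chains m k ℕ.* chains m (suc h ℕ.+ k)) ℕ.+ spread m k (suc h ℕ.+ k)
    summand m k = cong (λ d → d ℕ.* (chains m k ℕ.* chains m (suc h ℕ.+ k)) ℕ.+ spread m k (suc h ℕ.+ k))
                       (∣m-n+m∣≡n k (suc h))
    coeffs : ∀ m k → W (suc h) m k ℤ.+ Y.shift (W (suc h) m) k
           ≡ Y.shift (W (suc (suc h)) m) k ℤ.+ W h m k ℤ.+ X.shift hG m k ℤ.+ X.shift (W (suc h)) m k
    coeffs zero    zero    = refl
    coeffs zero    (suc k) = refl
    coeffs (suc m) zero    = cong +_ (trans (ℕₚ.+-identityʳ _)
      (trans (cong (spread (suc m) 0 (h ℕ.+ 0) ℕ.+_) (summand m 0))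
        (sym (ℕₚ.+-assoc (spread (suc m) 0 (h ℕ.+ 0)) _ _))))
    coeffs (suc m) (suc k) = cong +_ (trans
      (subst (λ n → spread (suc m) (suc k) (suc n) ℕ.+ spread (suc m) k (suc (h ℕ.+ k))
               ≡ spread (suc m) k (suc (suc (h ℕ.+ k))) ℕ.+ spread (suc m) (suc k) n ℕ.+ spread-summand m (suc k) (suc n))
        (sym (ℕₚ.+-suc h k)) (psum²-suc-suc (spread-summand m) k (suc (h ℕ.+ k))))
      (trans (cong (spread (suc m) k (suc (suc (h ℕ.+ k))) ℕ.+ spread (suc m) (suc k) (h ℕ.+ suc k) ℕ.+_) (summand m (suc k)))
        (sym (ℕₚ.+-assoc (spread (suc m) k (suc (suc (h ℕ.+ k))) ℕ.+ spread (suc m) (suc k) (h ℕ.+ suc k)) _ _))))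

  open Recurrences X.seriesRing ℤ⟦x,y⟧-morphism
  open Solution L x y G W G-zero G-suc W-zero W-suc
    using (B; E; E-zero; E-suc; solution)

  spread-series : ∀ m k → conv denom (λ a b → + spread a b b) m k ≡ numer m k
  -- The closed form carries a factor 2, cancelled coefficientwise in the integers.
  spread-series m k = ℤₚ.*-cancelˡ-≡ (+ 2) _ _ (begin
    + 2 ℤ.* conv denom (W 0) m k
      ≡⟨ cong (+ 2 ℤ.*_) (product m k) ⟩
    + 2 ℤ.* (B * (B * W 0)) m k
      ≡⟨ scalar-coeff (+ 2) (B * (B * W 0)) m k ⟨
    (⟦ + 2 ⟧ * (B * (B * W 0))) m k
      ≡⟨ solution (λ m k → Uniqueness.vanish E E-zero E-suc m k 0) m k ⟩
    (⟦ + 4 ⟧ * (x * y)) m k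
      ≡⟨ numer≈ m k ⟩
    + 2 ℤ.* numer m k ∎)
    where
    open ≡-Reasoning
    product : conv denom (W 0) ≈ B * (B * W 0)
    product m k = begin
      conv denom (W 0) m k ≡⟨ conv≈* denom (W 0) m k ⟩
      (denom * W 0) m k
        ≡⟨ ≈-*-cong {denom} {B * B} {W 0} {W 0}
             (≈-trans {denom} {basePoly * basePoly} {B * B} (conv≈* basePoly basePoly)
               (≈-*-cong {basePoly} {B} {basePoly} {B} basePoly≈ basePoly≈))
             (≈-refl {W 0}) m k ⟩
      (B * B * W 0) m k ≡⟨ ≈-*-assoc B B (W 0) m k ⟩
      (B * (B * W 0)) m k ∎

-- Order ideals as partitions, and their graph distance.

module Ideals where
  open import Data.Nat.Base using (_+_; _≤_; _<_; z≤n; s≤s; s≤s⁻¹; z<s; s<s; s<s⁻¹; _≤ᵇ_; _<ᵇ_)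
  open ℕₚ
  open ≡ using (refl; sym; trans; cong; cong₂; subst; subst₂)

  private variable
    m k a b n : ℕ

  ∧-true⁻ : ∀ {p q} → p ∧ q ≡ true → p ≡ true × q ≡ true
  ∧-true⁻ {true} e = refl , e

  ⇒-true⁻ : ∀ {p q} → not p ∨ q ≡ true → p ≡ true → q ≡ true
  ⇒-true⁻ {true} e refl = e

  ⇒-true⁺ : ∀ {p q} → (p ≡ true → q ≡ true) → not p ∨ q ≡ true
  ⇒-true⁺ {true}  f = f refl
  ⇒-true⁺ {false} f = refl

  true-ext : ∀ {p q} → (p ≡ true → q ≡ true) → (q ≡ true → p ≡ true) → p ≡ q
  true-ext {true}          f g = sym (f refl)
  true-ext {false} {true}  f g = g refl
  true-ext {false} {false} f g = refl

  allᵇ-tabulate⁻ : ∀ {A : Set} (p : A → Bool) (f : Fin n → A) →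
    allᵇ p (tabulate f) ≡ true → ∀ i → p (f i) ≡ true
  allᵇ-tabulate⁻ p f e zero    = proj₁ (∧-true⁻ e)
  allᵇ-tabulate⁻ p f e (suc i) = allᵇ-tabulate⁻ p (f ∘ suc) (proj₂ (∧-true⁻ e)) i

  allᵇ-tabulate⁺ : ∀ {A : Set} (p : A → Bool) (f : Fin n → A) →
    (∀ i → p (f i) ≡ true) → allᵇ p (tabulate f) ≡ true
  allᵇ-tabulate⁺ {zero}  p f h = refl
  allᵇ-tabulate⁺ {suc n} p f h = cong₂ _∧_ (h zero) (allᵇ-tabulate⁺ p (f ∘ suc) (h ∘ suc))

  DownClosed : Mat m k → Set
  DownClosed I = ∀ i j i′ j′ → toℕ i′ ≤ toℕ i → toℕ j′ ≤ toℕ j →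
                 (I ∋ i , j) ≡ true → (I ∋ i′ , j′) ≡ true

  ≤ᵇ-true⁺ : a ≤ b → (a ≤ᵇ b) ≡ true
  ≤ᵇ-true⁺ p = Equivalence.to T-≡ (≤⇒≤ᵇ p)

  ≤ᵇ-true⁻ : (a ≤ᵇ b) ≡ true → a ≤ b
  ≤ᵇ-true⁻ {a} p = ≤ᵇ⇒≤ a _ (Equivalence.from T-≡ p)

  isIdeal⁻ : ∀ (I : Mat m k) → IsIdeal I → DownClosed I
  isIdeal⁻ I e i j i′ j′ i′≤i j′≤j Iij = ⇒-true⁻
    (allᵇ-tabulate⁻ _ id (allᵇ-tabulate⁻ _ id
      (⇒-true⁻ (allᵇ-tabulate⁻ _ id (allᵇ-tabulate⁻ _ id e i) j) Iij) i′) j′)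
    (cong₂ _∧_ (≤ᵇ-true⁺ i′≤i) (≤ᵇ-true⁺ j′≤j))

  isIdeal⁺ : ∀ (I : Mat m k) → DownClosed I → IsIdeal I
  isIdeal⁺ I h = allᵇ-tabulate⁺ _ id λ i → allᵇ-tabulate⁺ _ id λ j → ⇒-true⁺ λ Iij →
    allᵇ-tabulate⁺ _ id λ i′ → allᵇ-tabulate⁺ _ id λ j′ → ⇒-true⁺ λ e →
      h i j i′ j′ (≤ᵇ-true⁻ (proj₁ (∧-true⁻ e))) (≤ᵇ-true⁻ (proj₂ (∧-true⁻ e))) Iij

  -- Ideals as weakly decreasing sequences of row lengths

  row : ℕ → Vec Bool k
  row {zero}  a       = []
  row {suc k} zero    = false ∷ row 0
  row {suc k} (suc a) = true ∷ row a

  size : Vec Bool k → ℕ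
  size []          = 0
  size (true  ∷ r) = suc (size r)
  size (false ∷ r) = size r

  fill : Vec ℕ m → Mat m k
  fill = Vec.map row

  sizes : Mat m k → Vec ℕ m
  sizes = Vec.map size

  -- Partitions with zero parts allowed; the index bounds the first part, which then becomes the
  -- bound for the rest.
  data Part : ℕ → Vec ℕ m → Set where
    []  : Part a []
    _∷_ : ∀ {v : Vec ℕ m} → b ≤ a → Part b v → Part a (b ∷ v)

  Part-weaken : ∀ {v : Vec ℕ m} → a ≤ b → Part a v → Part b v
  Part-weaken a≤b []      = []
  Part-weaken a≤b (p ∷ q) = ≤-trans p a≤b ∷ q

  lookup-row⁺ : ∀ (j : Fin k) → toℕ j < a → lookup (row a) j ≡ true
  lookup-row⁺ {a = suc a} zero    p = refl
  lookup-row⁺ {a = suc a} (suc j) p = lookup-row⁺ j (s<s⁻¹ p)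

  lookup-row⁻ : ∀ (j : Fin k) → lookup (row a) j ≡ true → toℕ j < a
  lookup-row⁻ {a = zero}  (suc j) p = contradiction (lookup-row⁻ j p) λ ()
  lookup-row⁻ {a = suc a} zero    p = z<s
  lookup-row⁻ {a = suc a} (suc j) p = s<s (lookup-row⁻ j p)

  size≤ : ∀ (r : Vec Bool k) → size r ≤ k
  size≤ []          = z≤n
  size≤ (true  ∷ r) = s≤s (size≤ r)
  size≤ (false ∷ r) = m≤n⇒m≤1+n (size≤ r)

  size-row : a ≤ k → size (row {k} a) ≡ a
  size-row {k = zero}  z≤n     = refl
  size-row {k = suc k} z≤n     = size-row {k = k} z≤n
  size-row             (s≤s p) = cong suc (size-row p)

  -- The inclusion is tested at the last cell of `row a`; as `row` cuts off at width k, that cell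
  -- exists because a ≤ k.
  row-⊆⇒≤ : a ≤ k → (∀ (j : Fin k) → lookup (row a) j ≡ true → lookup (row b) j ≡ true) → a ≤ b
  row-⊆⇒≤ {zero}      a≤k h = z≤n
  row-⊆⇒≤ {suc a} {b = b} a<k h = subst (_< b) (toℕ-fromℕ< a<k)
    (lookup-row⁻ (fromℕ< a<k) (h (fromℕ< a<k)
      (lookup-row⁺ (fromℕ< a<k) (s≤s (≤-reflexive (toℕ-fromℕ< a<k))))))

  emptyᵇ initialᵇ : Vec Bool k → Bool
  emptyᵇ []          = true
  emptyᵇ (true  ∷ r) = false
  emptyᵇ (false ∷ r) = emptyᵇ r
  initialᵇ []          = true
  initialᵇ (true  ∷ r) = initialᵇ r
  initialᵇ (false ∷ r) = emptyᵇ r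

  emptyᵇ⁻ : ∀ (r : Vec Bool k) → emptyᵇ r ≡ true → row (size r) ≡ r × size r ≡ 0
  emptyᵇ⁻ []          e = refl , refl
  emptyᵇ⁻ (false ∷ r) e with size r | emptyᵇ⁻ r e
  ... | _ | p , refl = cong (false ∷_) p , refl

  initialᵇ⁻ : ∀ (r : Vec Bool k) → initialᵇ r ≡ true → row (size r) ≡ r
  initialᵇ⁻ []          e = refl
  initialᵇ⁻ (true  ∷ r) e = cong (true ∷_) (initialᵇ⁻ r e)
  initialᵇ⁻ (false ∷ r) e = proj₁ (emptyᵇ⁻ (false ∷ r) e)

  emptyᵇ⁺ : ∀ (r : Vec Bool k) → (∀ j → lookup r j ≢ true) → emptyᵇ r ≡ true
  emptyᵇ⁺ []          h = refl
  emptyᵇ⁺ (true  ∷ r) h = contradiction refl (h zero)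
  emptyᵇ⁺ (false ∷ r) h = emptyᵇ⁺ r (h ∘ suc)

  initialᵇ⁺ : ∀ (r : Vec Bool k) →
    (∀ j j′ → toℕ j′ ≤ toℕ j → lookup r j ≡ true → lookup r j′ ≡ true) → initialᵇ r ≡ true
  initialᵇ⁺ []          h = refl
  initialᵇ⁺ (true  ∷ r) h = initialᵇ⁺ r λ j j′ p → h (suc j) (suc j′) (s≤s p)
  initialᵇ⁺ (false ∷ r) h = emptyᵇ⁺ r λ j e → contradiction (h (suc j) zero z≤n e) λ ()

  -- A test that consumes the matrix row by row, so that sums over ideals can be split along the
  -- first row. The bound is phrased as `<ᵇ suc a` because this reduces when both sides lose a
  -- successor.
  chainᵇ : ℕ → Mat m k → Bool
  chainᵇ a []      = true
  chainᵇ a (r ∷ M) = (initialᵇ r ∧ (size r <ᵇ suc a)) ∧ chainᵇ (size r) M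

  chainᵇ⁻ : ∀ (M : Mat m k) → chainᵇ a M ≡ true → Part a (sizes M) × fill (sizes M) ≡ M
  chainᵇ⁻ []      e = [] , refl
  chainᵇ⁻ (r ∷ M) e =
    let head , tail = ∧-true⁻ e
        init , le   = ∧-true⁻ {initialᵇ r} head
        part , same = chainᵇ⁻ M tail
    in ≤ᵇ-true⁻ {suc (size r)} le |> part , cong₂ _∷_ (initialᵇ⁻ r init) same
    where
    _|>_ : ∀ {v : Vec ℕ m} → suc b ≤ suc a → Part b v → Part a (b ∷ v)
    s≤s p |> q = p ∷ q

  sizes-fill : ∀ {v : Vec ℕ m} → a ≤ k → Part a v → sizes (fill {k = k} v) ≡ v
  sizes-fill a≤k []      = refl
  sizes-fill a≤k (p ∷ q) = cong₂ _∷_ (size-row (≤-trans p a≤k)) (sizes-fill (≤-trans p a≤k) q)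

  -- The induction carries a bound `a` on the occupied columns. It becomes `size r` for the later
  -- rows, since each of their cells forces the cell of the first row in the same column.
  DownClosed⇒chainᵇ : ∀ (M : Mat m k) → DownClosed M →
    (∀ i j → (M ∋ i , j) ≡ true → toℕ j < a) → a ≤ k → chainᵇ a M ≡ true
  DownClosed⇒chainᵇ []          h bound a≤k = refl
  DownClosed⇒chainᵇ {a = a} (r ∷ M) h bound a≤k = cong₂ _∧_
    (cong₂ _∧_ init (≤ᵇ-true⁺ (s≤s (row-⊆⇒≤ (size≤ r) λ j e →
      lookup-row⁺ j (bound zero j (subst (λ r → lookup r j ≡ true) row≡r e))))))
    (DownClosed⇒chainᵇ M (λ i j i′ j′ p → h (suc i) j (suc i′) j′ (s≤s p))
      (λ i j e → lookup-row⁻ j (subst (λ r → lookup r j ≡ true) (sym row≡r)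
        (h (suc i) j zero j z≤n ≤-refl e)))
      (size≤ r))
    where
    init : initialᵇ r ≡ true
    init = initialᵇ⁺ r λ j j′ p → h zero j zero j′ z≤n p
    row≡r : row (size r) ≡ r
    row≡r = initialᵇ⁻ r init

  Part-lookup≤ : ∀ {v : Vec ℕ m} → Part a v → ∀ i → lookup v i ≤ a
  Part-lookup≤ (p ∷ q) zero    = p
  Part-lookup≤ (p ∷ q) (suc i) = ≤-trans (Part-lookup≤ q i) p

  Part-antitone : ∀ {v : Vec ℕ m} → Part a v → ∀ i i′ → toℕ i′ ≤ toℕ i → lookup v i ≤ lookup v i′
  Part-antitone (p ∷ q) zero    zero     _       = ≤-refl
  Part-antitone (p ∷ q) (suc i) zero     _       = Part-lookup≤ q i
  Part-antitone (p ∷ q) (suc i) (suc i′) (s≤s l) = Part-antitone q i i′ l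

  fill∋⁺ : ∀ (v : Vec ℕ m) i (j : Fin k) → toℕ j < lookup v i → (fill v ∋ i , j) ≡ true
  fill∋⁺ v i j p = trans (cong (λ r → lookup r j) (lookup-map i row v)) (lookup-row⁺ j p)

  fill∋⁻ : ∀ (v : Vec ℕ m) i (j : Fin k) → (fill v ∋ i , j) ≡ true → toℕ j < lookup v i
  fill∋⁻ v i j e = lookup-row⁻ j (trans (sym (cong (λ r → lookup r j) (lookup-map i row v))) e)

  fill-isIdeal : ∀ k {v : Vec ℕ m} → Part a v → IsIdeal (fill {k = k} v)
  fill-isIdeal k {v} part = isIdeal⁺ (fill {k = k} v) λ i j i′ j′ i′≤i j′≤j e → fill∋⁺ v i′ j′
    (≤-<-trans j′≤j (<-≤-trans (fill∋⁻ v i j e) (Part-antitone part i i′ i′≤i)))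

  -- An equality of Booleans rather than an equivalence, so that the test can be replaced inside a
  -- sum.
  isIdeal≡chainᵇ : ∀ (I : Mat m k) → isIdeal I ≡ chainᵇ k I
  isIdeal≡chainᵇ {k = k} I = true-ext
    (λ e → DownClosed⇒chainᵇ I (isIdeal⁻ I e) (λ _ j _ → toℕ<n j) ≤-refl)
    (λ e → let part , same = chainᵇ⁻ I e in subst IsIdeal same (fill-isIdeal k part))

  IsIdeal⇒Part : ∀ (I : Mat m k) → IsIdeal I → Part k (sizes I) × fill (sizes I) ≡ I
  IsIdeal⇒Part I e = chainᵇ⁻ I (trans (sym (isIdeal≡chainᵇ I)) e)

  infix 4 _≤ᵛ_
  _≤ᵛ_ : Vec ℕ m → Vec ℕ m → Set
  _≤ᵛ_ = Pointwise _≤_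

  fill-mono : ∀ {u v : Vec ℕ m} → u ≤ᵛ v → fill {k = k} u ⊆ fill v
  fill-mono {u = u} {v} u≤v i j e =
    fill∋⁺ v i j (<-≤-trans (fill∋⁻ u i j e) (Pointwise.lookup u≤v i))

  fill-cancel-⊆ : ∀ {u v : Vec ℕ m} → a ≤ k → Part a u → fill {k = k} u ⊆ fill v → u ≤ᵛ v
  fill-cancel-⊆ {v = []}    a≤k []      h = []
  fill-cancel-⊆ {v = _ ∷ _} a≤k (p ∷ q) h =
    row-⊆⇒≤ (≤-trans p a≤k) (h zero) ∷ fill-cancel-⊆ (≤-trans p a≤k) q (h ∘ suc)

  -- Distances

  dist : Vec ℕ m → Vec ℕ m → ℕ
  dist []      []      = 0
  dist (a ∷ u) (b ∷ v) = ∣ a - b ∣ + dist u v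

  dist-refl : ∀ (u : Vec ℕ m) → dist u u ≡ 0
  dist-refl []      = refl
  dist-refl (a ∷ u) = cong₂ _+_ (∣n-n∣≡0 a) (dist-refl u)

  dist-sym : ∀ (u v : Vec ℕ m) → dist u v ≡ dist v u
  dist-sym []      []      = refl
  dist-sym (a ∷ u) (b ∷ v) = cong₂ _+_ (∣-∣-comm a b) (dist-sym u v)

  dist-triangle : ∀ (u v w : Vec ℕ m) → dist u w ≤ dist u v + dist v w
  dist-triangle []      []      []      = z≤n
  dist-triangle (a ∷ u) (b ∷ v) (c ∷ w) = begin
    ∣ a - c ∣ + dist u w                               ≤⟨ +-mono-≤ (∣-∣-triangle a b c) (dist-triangle u v w) ⟩
    (∣ a - b ∣ + ∣ b - c ∣) + (dist u v + dist v w)    ≡⟨ interchange ∣ a - b ∣ _ _ _ ⟩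
    (∣ a - b ∣ + dist u v) + (∣ b - c ∣ + dist v w)    ∎
    where
    open ≤-Reasoning
    open import Algebra.Properties.CommutativeSemigroup +-commutativeSemigroup using (interchange)

  dist≡0⇒≡ : ∀ (u v : Vec ℕ m) → dist u v ≡ 0 → u ≡ v
  dist≡0⇒≡ []      []      e = refl
  dist≡0⇒≡ (a ∷ u) (b ∷ v) e = cong₂ _∷_ (∣m-n∣≡0⇒m≡n (m+n≡0⇒m≡0 ∣ a - b ∣ e))
                                         (dist≡0⇒≡ u v (m+n≡0⇒n≡0 ∣ a - b ∣ e))

  ≤ᵛ-antisym : ∀ {u v : Vec ℕ m} → u ≤ᵛ v → v ≤ᵛ u → u ≡ v
  ≤ᵛ-antisym []      []      = refl
  ≤ᵛ-antisym (p ∷ q) (r ∷ s) = cong₂ _∷_ (≤-antisym p r) (≤ᵛ-antisym q s)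

  data Increment : Vec ℕ m → Vec ℕ m → Set where
    here  : ∀ {u : Vec ℕ m} → Increment (a ∷ u) (suc a ∷ u)
    there : ∀ {u v : Vec ℕ m} → Increment u v → Increment (a ∷ u) (a ∷ v)

  Increment⇒≤ᵛ : ∀ {u v : Vec ℕ m} → Increment u v → u ≤ᵛ v
  Increment⇒≤ᵛ here      = n≤1+n _ ∷ Pointwise.refl ≤-refl
  Increment⇒≤ᵛ (there s) = ≤-refl ∷ Increment⇒≤ᵛ s

  Increment⇒dist≡1 : ∀ {u v : Vec ℕ m} → Increment u v → dist u v ≡ 1
  Increment⇒dist≡1 (here {a = a} {u}) = cong₂ _+_ (trans (cong ∣ a -_∣ (+-comm 1 a)) (∣m-m+n∣≡n a 1)) (dist-refl u)
  Increment⇒dist≡1 (there {a = a} s)  = cong₂ _+_ (∣n-n∣≡0 a) (Increment⇒dist≡1 s)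

  -- Away from the raised entry the two bounds coincide, and at that entry nothing fits strictly
  -- between a and a + 1.
  Increment-between : ∀ {u t v : Vec ℕ m} → Increment u v → u ≤ᵛ t → t ≤ᵛ v → t ≡ u ⊎ t ≡ v
  Increment-between here (p ∷ ps) (q ∷ qs) with ≤ᵛ-antisym qs ps | m≤n⇒m<n∨m≡n q
  ... | refl | inj₁ r    = inj₁ (cong (_∷ _) (≤-antisym (s≤s⁻¹ r) p))
  ... | refl | inj₂ refl = inj₂ refl
  Increment-between (there s) (p ∷ ps) (q ∷ qs) with ≤-antisym q p | Increment-between s ps qs
  ... | refl | inj₁ refl = inj₁ refl
  ... | refl | inj₂ refl = inj₂ refl

  -- Since v is weakly decreasing and b < c ≤ a, the first row where u falls short of v can
  -- always be lengthened.
  increment-towards : ∀ {u v : Vec ℕ m} → Part a u → Part a v →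
    v ≤ᵛ u ⊎ (∃[ w ] Increment u w × Part a w × dist u v ≡ suc (dist w v) × (u ≤ᵛ v → w ≤ᵛ v))
  increment-towards [] [] = inj₁ []
  increment-towards {u = b ∷ u} {c ∷ v} (p ∷ ps) (q ∷ qs) with b <? c
  ... | yes b<c = inj₂ (suc b ∷ u , here , ≤-trans b<c q ∷ Part-weaken (n≤1+n b) ps
                       , cong (_+ dist u v) (closer b<c) , λ { (_ ∷ u≤v) → b<c ∷ u≤v })
    where
    closer : ∀ {b c} → b < c → ∣ b - c ∣ ≡ suc ∣ suc b - c ∣
    closer {zero}  {suc c} _       = refl
    closer {suc b} {suc c} (s≤s p) = closer p
  ... | no b≮c with increment-towards ps (Part-weaken (≮⇒≥ b≮c) qs)
  ...   | inj₁ v≤u = inj₁ (≮⇒≥ b≮c ∷ v≤u)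
  ...   | inj₂ (w , s , part , eq , w≤v) = inj₂ (b ∷ w , there s , p ∷ part
          , trans (cong (_+_ ∣ b - c ∣) eq) (+-suc ∣ b - c ∣ _) , λ { (b≤c ∷ u≤v) → b≤c ∷ w≤v u≤v })

  fill-injective : ∀ {u v : Vec ℕ m} → Part k u → Part k v → fill {k = k} u ≡ fill v → u ≡ v
  fill-injective {u = u} {v} pu pv e =
    trans (sym (sizes-fill ≤-refl pu)) (trans (cong sizes e) (sizes-fill ≤-refl pv))

  -- An ideal strictly between would come from a sequence caught between u and v, which
  -- `Increment-between` forces to be one of them.
  Increment⇒Covers : ∀ {u v : Vec ℕ m} → Part k u → Part k v → Increment u v →
    Covers (fill {k = k} u) (fill v)
  Increment⇒Covers {k = k} {u = u} {v} pu pv s =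
    fill-isIdeal k pu , fill-isIdeal k pv , (fill-mono (Increment⇒≤ᵛ s) , u≢v) , nothing-between
    where
    u≢v : fill u ≢ fill v
    u≢v e = contradiction (trans (sym (Increment⇒dist≡1 s))
      (trans (cong (λ t → dist t v) (fill-injective pu pv e)) (dist-refl v))) λ ()
    nothing-between : ∀ K → IsIdeal K → fill u ⊂ K → K ⊂ fill v → _
    nothing-between K K-ideal (u⊆K , u≢K) (K⊆v , K≢v) with IsIdeal⇒Part K K-ideal
    ... | pK , same with Increment-between s
            (fill-cancel-⊆ ≤-refl pu (subst (fill u ⊆_) (sym same) u⊆K))
            (fill-cancel-⊆ ≤-refl pK (subst (_⊆ fill v) (sym same) K⊆v))
    ...   | inj₁ t≡u = u≢K (trans (cong fill (sym t≡u)) same)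
    ...   | inj₂ t≡v = K≢v (trans (sym same) (cong fill t≡v))

  distance : Mat m k → Mat m k → ℕ
  distance I J = dist (sizes I) (sizes J)

  -- One increment from I towards J stays below J and gives an ideal strictly above I; as J covers
  -- I, it is J itself.
  Covers⇒distance≡1 : ∀ (I J : Mat m k) → Covers I J → distance I J ≡ 1
  Covers⇒distance≡1 I J (I-ideal , J-ideal , (I⊆J , I≢J) , minimal)
    with IsIdeal⇒Part I I-ideal | IsIdeal⇒Part J J-ideal
  ... | pI , eI | pJ , eJ
    with u≤v ← fill-cancel-⊆ ≤-refl pI (subst₂ _⊆_ (sym eI) (sym eJ) I⊆J)
    with increment-towards pI pJ
  ... | inj₁ v≤u = contradiction (trans (sym eI) (trans (cong fill (≤ᵛ-antisym u≤v v≤u)) eJ)) I≢J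
  ... | inj₂ (w , s , pw , _ , w≤v) with ≡-dec _≟_ w (sizes J)
  ...   | yes refl = Increment⇒dist≡1 s
  ...   | no w≢v with Increment⇒Covers pI pw s
  ...     | _ , w-ideal , I⊂w , _ = contradiction
              (subst (fill w ⊆_) eJ (fill-mono (w≤v u≤v))
              , λ e → w≢v (fill-injective pw pJ (trans e (sym eJ))))
              (minimal (fill w) w-ideal (subst (_⊂ fill w) eI I⊂w))

  Adj⇒distance≡1 : ∀ {I J : Mat m k} → Adj I J → distance I J ≡ 1
  Adj⇒distance≡1 {I = I} {J} (up c)   = Covers⇒distance≡1 I J c
  Adj⇒distance≡1 {I = I} {J} (down c) = trans (dist-sym (sizes I) (sizes J)) (Covers⇒distance≡1 J I c)

  -- The triangle inequality along the walk, each edge having ℓ¹-length one.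
  Walk⇒distance≤ : ∀ {I J : Mat m k} → Walk I J n → distance I J ≤ n
  Walk⇒distance≤ {I = I} (nil _) = ≤-reflexive (dist-refl (sizes I))
  Walk⇒distance≤ {I = I} {J} (step {J = K} e w) = ≤-trans (dist-triangle (sizes I) (sizes K) (sizes J))
    (+-mono-≤ (≤-reflexive (Adj⇒distance≡1 e)) (Walk⇒distance≤ w))

  snoc : ∀ {I J K : Mat m k} → Walk I J n → Adj J K → IsIdeal K → Walk I K (suc n)
  snoc (nil _)    e h = step e (nil h)
  snoc (step d w) e h = step d (snoc w e h)

  -- Induction on the distance. If u can grow towards v, the walk starts with that step up.
  -- Otherwise v ≤ u, and growing v towards u yields the last step of the walk, taken downwards.
  fill-walk : ∀ {u v : Vec ℕ m} → Part k u → Part k v → dist u v ≡ n → Walk (fill {k = k} u) (fill v) n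
  fill-walk {k = k} {n = zero} {u} {v} pu pv eq =
    subst (λ t → Walk (fill u) (fill t) 0) (dist≡0⇒≡ u v eq) (nil (fill-isIdeal k pu))
  fill-walk {k = k} {n = suc n} {u} {v} pu pv eq with increment-towards pu pv
  ... | inj₂ (w , s , pw , closer , _) =
    step (up (Increment⇒Covers pu pw s)) (fill-walk pw pv (suc-injective (trans (sym closer) eq)))
  ... | inj₁ v≤u with increment-towards pv pu
  -- If neither side can grow then u = v, against the positive distance.
  ...   | inj₁ u≤v = contradiction (trans (sym eq)
            (trans (cong (dist u) (≤ᵛ-antisym v≤u u≤v)) (dist-refl u))) λ ()
  ...   | inj₂ (w , s , pw , closer , _) = snoc
            (fill-walk pu pw (suc-injective (trans (sym (trans (dist-sym u v) (trans closer (cong suc (dist-sym w u))))) eq)))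
            (down (Increment⇒Covers pv pw s)) (fill-isIdeal k pv)

  distance-isDist : ∀ (I J : Mat m k) → IsIdeal I → IsIdeal J → IsDist I J (distance I J)
  distance-isDist I J I-ideal J-ideal with IsIdeal⇒Part I I-ideal | IsIdeal⇒Part J J-ideal
  ... | pI , eI | pJ , eJ = subst₂ (λ I′ J′ → Walk I′ J′ (distance I J)) eI eJ (fill-walk pI pJ refl)
                          , λ _ → Walk⇒distance≤

-- Summing the distances over the list of ideals.

module WienerSum where
  open Counting
  open Ideals
  open import Data.Nat.Base using (_+_; _*_; _≤_; _<ᵇ_; z≤n; s≤s)
  open ℕₚ
  open ℕ-Solver using (solve-∀)
  open Algebra.Properties.CommutativeSemigroup +-commutativeSemigroup using (interchange)
  open ≡ using (refl; sym; trans; cong; cong₂; module ≡-Reasoning)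
  open ≡-Reasoning

  private variable
    A C : Set
    m k a b : ℕ

  sumOver : List A → (A → ℕ) → ℕ
  sumOver xs f = sumℕ (map f xs)

  -- An indicator weight: filtered sums become sums over all matrices, which can be taken row by
  -- row.
  when : Bool → ℕ → ℕ
  when p n = if p then n else 0

  sumOver-cong : ∀ {f g : A → ℕ} → (∀ x → f x ≡ g x) → ∀ xs → sumOver xs f ≡ sumOver xs g
  sumOver-cong p xs = cong sumℕ (map-cong p xs)

  sumOver-++ : ∀ (f : A → ℕ) xs ys → sumOver (xs ++ ys) f ≡ sumOver xs f + sumOver ys f
  sumOver-++ f xs ys = trans (cong sumℕ (map-++ f xs ys)) (sum-++ (map f xs) (map f ys))

  sumOver-map : ∀ (f : C → ℕ) (g : A → C) xs → sumOver (map g xs) f ≡ sumOver xs (f ∘ g)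
  sumOver-map f g xs = cong sumℕ (sym (map-∘ xs))

  sumOver-concatMap : ∀ (f : C → ℕ) (g : A → List C) xs →
    sumOver (concatMap g xs) f ≡ sumOver xs (λ x → sumOver (g x) f)
  sumOver-concatMap f g []       = refl
  sumOver-concatMap f g (x ∷ xs) =
    trans (sumOver-++ f (g x) (concatMap g xs)) (cong (_+_ (sumOver (g x) f)) (sumOver-concatMap f g xs))

  sumOver-+ : ∀ (f g : A → ℕ) xs → sumOver xs (λ x → f x + g x) ≡ sumOver xs f + sumOver xs g
  sumOver-+ f g []       = refl
  sumOver-+ f g (x ∷ xs) =
    trans (cong (_+_ (f x + g x)) (sumOver-+ f g xs)) (interchange (f x) (g x) _ _)

  sumOver-zero : ∀ (xs : List A) → sumOver xs (λ _ → 0) ≡ 0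
  sumOver-zero []       = refl
  sumOver-zero (_ ∷ xs) = sumOver-zero xs

  sumOver-when : ∀ p (f : A → ℕ) xs → sumOver xs (λ x → when p (f x)) ≡ when p (sumOver xs f)
  sumOver-when true  f xs = refl
  sumOver-when false f xs = sumOver-zero xs

  sumOver-filter : ∀ (p : A → Bool) (f : A → ℕ) xs →
    sumOver (filter (λ x → p x ≟ᵇ true) xs) f ≡ sumOver xs (λ x → when (p x) (f x))
  sumOver-filter p f []       = refl
  sumOver-filter p f (x ∷ xs) with p x
  ... | true  = cong (_+_ (f x)) (sumOver-filter p f xs)
  ... | false = sumOver-filter p f xs

  when-∧ : ∀ p q n → when (p ∧ q) n ≡ when p (when q n)
  when-∧ true  q n = refl
  when-∧ false q n = refl

  rows : ∀ k → List (Vec Bool k)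
  rows = allVecsOf (true ∷ false ∷ [])

  sumOver-rows : ∀ k (f : Vec Bool (suc k) → ℕ) →
    sumOver (rows (suc k)) f ≡ sumOver (rows k) (f ∘ (true ∷_)) + sumOver (rows k) (f ∘ (false ∷_))
  sumOver-rows k f = begin
    sumOver (rows (suc k)) f
      ≡⟨ sumOver-concatMap f (λ x → map (x ∷_) (rows k)) (true ∷ false ∷ []) ⟩
    sumOver (map (true ∷_) (rows k)) f + (sumOver (map (false ∷_) (rows k)) f + 0)
      ≡⟨ cong₂ _+_ (sumOver-map f (true ∷_) (rows k))
                   (trans (+-identityʳ _) (sumOver-map f (false ∷_) (rows k))) ⟩
    sumOver (rows k) (f ∘ (true ∷_)) + sumOver (rows k) (f ∘ (false ∷_)) ∎

  -- Exactly one row in the list has no cell, and its size is 0.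
  sumOver-empty-rows : ∀ k (H : ℕ → ℕ) →
    sumOver (rows k) (λ r → when (emptyᵇ r) (H (size r))) ≡ H 0
  sumOver-empty-rows zero    H = +-identityʳ (H 0)
  sumOver-empty-rows (suc k) H = begin
    sumOver (rows (suc k)) (λ r → when (emptyᵇ r) (H (size r)))
      ≡⟨ sumOver-rows k (λ r → when (emptyᵇ r) (H (size r))) ⟩
    sumOver (rows k) (λ _ → 0) + sumOver (rows k) (λ r → when (emptyᵇ r) (H (size r)))
      ≡⟨ cong₂ _+_ (sumOver-zero (rows k)) (sumOver-empty-rows k H) ⟩
    H 0 ∎

  -- An initial row is determined by its size, and a ≤ k ensures that each size up to a occurs.
  sumOver-initial-rows : a ≤ k → ∀ (H : ℕ → ℕ) →
    sumOver (rows k) (λ r → when (initialᵇ r ∧ (size r <ᵇ suc a)) (H (size r))) ≡ psum H a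
  sumOver-initial-rows {zero}  {zero}  z≤n H = +-identityʳ (H 0)
  sumOver-initial-rows {a} {suc k} a≤1+k H = begin
    sumOver (rows (suc k)) (λ r → when (initialᵇ r ∧ (size r <ᵇ suc a)) (H (size r)))
      ≡⟨ sumOver-rows k (λ r → when (initialᵇ r ∧ (size r <ᵇ suc a)) (H (size r))) ⟩
    sumOver (rows k) (λ r → when (initialᵇ r ∧ (suc (size r) <ᵇ suc a)) (H (suc (size r))))
      + sumOver (rows k) (λ r → when (emptyᵇ r ∧ (size r <ᵇ suc a)) (H (size r)))
      -- A row starting with `false` is initial only if it is empty; size 0 meets the bound, leaving
      -- `H 0`.
      ≡⟨ cong (_+_ (sumOver (rows k) _)) (trans
           (sumOver-cong (λ r → when-∧ (emptyᵇ r) (size r <ᵇ suc a) (H (size r))) (rows k))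
           (sumOver-empty-rows k (λ s → when (s <ᵇ suc a) (H s)))) ⟩
    sumOver (rows k) (λ r → when (initialᵇ r ∧ (suc (size r) <ᵇ suc a)) (H (suc (size r)))) + H 0
      ≡⟨ nonempty a≤1+k ⟩
    psum H a ∎
    where
    nonempty : ∀ {a} → a ≤ suc k →
      sumOver (rows k) (λ r → when (initialᵇ r ∧ (suc (size r) <ᵇ suc a)) (H (suc (size r)))) + H 0 ≡ psum H a
    nonempty {zero} _ = cong (_+ H 0) (trans
      (sumOver-cong (λ r → never (initialᵇ r) (H (suc (size r)))) (rows k)) (sumOver-zero (rows k)))
      where
      never : ∀ p n → when (p ∧ false) n ≡ 0
      never true  n = refl
      never false n = refl
    -- Removing the leading `true` lowers size and bound by one and shifts `H`.
    nonempty {suc a} (s≤s a≤k) = trans (cong (_+ H 0) (sumOver-initial-rows a≤k (H ∘ suc))) (sym (psum-head H a))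

  -- The width k of the matrices stays fixed while the bound shrinks from row to row, so the two are
  -- separate parameters.
  sumChains : ∀ m k → ℕ → (Mat m k → ℕ) → ℕ
  sumChains m k a f = sumOver (allMats m k) (λ M → when (chainᵇ a M) (f M))

  sumChains-cong : ∀ {f g : Mat m k → ℕ} → (∀ M → f M ≡ g M) → ∀ a → sumChains m k a f ≡ sumChains m k a g
  sumChains-cong {m} {k} p a = sumOver-cong (λ M → cong (when (chainᵇ a M)) (p M)) (allMats m k)

  sumChains-+ : ∀ (f g : Mat m k → ℕ) a →
    sumChains m k a (λ M → f M + g M) ≡ sumChains m k a f + sumChains m k a g
  sumChains-+ {m} {k} f g a = trans
    (sumOver-cong (λ M → when-+ (chainᵇ a M) (f M) (g M)) (allMats m k))
    (sumOver-+ (λ M → when (chainᵇ a M) (f M)) (λ M → when (chainᵇ a M) (g M)) (allMats m k))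
    where
    when-+ : ∀ p x y → when p (x + y) ≡ when p x + when p y
    when-+ true  x y = refl
    when-+ false x y = refl

  sumChains-psum : ∀ (F : ℕ → Mat m k → ℕ) a b →
    sumChains m k a (λ M → psum (λ j → F j M) b) ≡ psum (λ j → sumChains m k a (F j)) b
  sumChains-psum F a zero    = refl
  sumChains-psum {m} {k} F a (suc b) = trans
    (sumChains-+ (λ M → psum (λ j → F j M) b) (F (suc b)) a)
    (cong (_+ sumChains m k a (F (suc b))) (sumChains-psum F a b))

  -- Groups the matrices by their first row, whose size is the bound for the others; `F` records
  -- that `f` sees this row only through its size.
  sumChains-suc : ∀ (f : Mat (suc m) k → ℕ) (F : ℕ → Mat m k → ℕ) →
    (∀ r M → f (r ∷ M) ≡ F (size r) M) → a ≤ k →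
    sumChains (suc m) k a f ≡ psum (λ i → sumChains m k i (F i)) a
  sumChains-suc {m} {k} {a} f F f≗F a≤k = begin
    sumChains (suc m) k a f
      ≡⟨ sumOver-concatMap (λ M → when (chainᵇ a M) (f M)) (λ r → map (r ∷_) (allMats m k)) (rows k) ⟩
    sumOver (rows k) (λ r → sumOver (map (r ∷_) (allMats m k)) (λ M → when (chainᵇ a M) (f M)))
      ≡⟨ sumOver-cong (λ r → trans (sumOver-map (λ M → when (chainᵇ a M) (f M)) (r ∷_) (allMats m k)) (first-row r))
           (rows k) ⟩
    sumOver (rows k) (λ r → when (initialᵇ r ∧ (size r <ᵇ suc a)) (sumChains m k (size r) (F (size r))))
      ≡⟨ sumOver-initial-rows a≤k (λ i → sumChains m k i (F i)) ⟩
    psum (λ i → sumChains m k i (F i)) a ∎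
    where
    first-row : ∀ r → sumOver (allMats m k) (λ M → when (chainᵇ a (r ∷ M)) (f (r ∷ M)))
      ≡ when (initialᵇ r ∧ (size r <ᵇ suc a)) (sumChains m k (size r) (F (size r)))
    first-row r = trans
      (sumOver-cong (λ M → trans (when-∧ (initialᵇ r ∧ (size r <ᵇ suc a)) (chainᵇ (size r) M) (f (r ∷ M)))
        (cong (λ n → when (initialᵇ r ∧ (size r <ᵇ suc a)) (when (chainᵇ (size r) M) n)) (f≗F r M))) (allMats m k))
      (sumOver-when (initialᵇ r ∧ (size r <ᵇ suc a)) (λ M → when (chainᵇ (size r) M) (F (size r) M)) (allMats m k))

  sumChains-const : ∀ m n → a ≤ k → sumChains m k a (λ _ → n) ≡ n * chains m a
  sumChains-const zero n a≤k = trans (+-identityʳ n) (sym (*-identityʳ n))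
  sumChains-const {a} {k} (suc m) n a≤k = begin
    sumChains (suc m) k a (λ _ → n)          ≡⟨ sumChains-suc (λ _ → n) (λ _ _ → n) (λ _ _ → refl) a≤k ⟩
    psum (λ i → sumChains m k i (λ _ → n)) a ≡⟨ psum-cong-≤ a (λ i≤a → sumChains-const m n (≤-trans i≤a a≤k)) ⟩
    psum (λ i → n * chains m i) a            ≡⟨ psum-* n (chains m) a ⟩
    n * psum (chains m) a ∎

  -- Splitting off both first rows reproduces the recursion of `spread`. The bounds a and b are
  -- independent because first rows of sizes i and j leave different bounds for the tails.
  sumChains-distance : ∀ m → a ≤ k → b ≤ k →
    sumChains m k a (λ I → sumChains m k b (distance I)) ≡ spread m a b
  sumChains-distance zero a≤k b≤k = refl
  sumChains-distance {a} {k} {b} (suc m) a≤k b≤k = begin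
    sumChains (suc m) k a (λ I → sumChains (suc m) k b (distance I))
      ≡⟨ sumChains-suc (λ I → sumChains (suc m) k b (distance I))
           (λ i I → psum (λ j → sumChains m k j (λ J → ∣ i - j ∣ + distance I J)) b)
           -- The inner sum is split for a fixed first row r, which shows that it depends on r only
           -- through `size r`.
           (λ r I → sumChains-suc (distance (r ∷ I)) (λ j J → ∣ size r - j ∣ + distance I J) (λ _ _ → refl) b≤k)
           a≤k ⟩
    psum (λ i → sumChains m k i (λ I → psum (λ j → sumChains m k j (λ J → ∣ i - j ∣ + distance I J)) b)) a
      ≡⟨ psum-cong (λ i → sumChains-psum (λ j I → sumChains m k j (λ J → ∣ i - j ∣ + distance I J)) i b) a ⟩
    psum (λ i → psum (λ j → sumChains m k i (λ I → sumChains m k j (λ J → ∣ i - j ∣ + distance I J))) b) a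
      ≡⟨ psum-cong-≤ a (λ i≤a → psum-cong-≤ b (λ j≤b → summand (≤-trans i≤a a≤k) (≤-trans j≤b b≤k))) ⟩
    spread (suc m) a b ∎
    where
    summand : ∀ {i j} → i ≤ k → j ≤ k →
      sumChains m k i (λ I → sumChains m k j (λ J → ∣ i - j ∣ + distance I J)) ≡ spread-summand m i j
    summand {i} {j} i≤k j≤k = begin
      sumChains m k i (λ I → sumChains m k j (λ J → ∣ i - j ∣ + distance I J))
        ≡⟨ sumChains-cong (λ I → trans (sumChains-+ (λ _ → ∣ i - j ∣) (distance I) j)
             (cong (_+ sumChains m k j (distance I)) (sumChains-const m ∣ i - j ∣ j≤k))) i ⟩
      sumChains m k i (λ I → ∣ i - j ∣ * chains m j + sumChains m k j (distance I))
        ≡⟨ sumChains-+ (λ _ → ∣ i - j ∣ * chains m j) (λ I → sumChains m k j (distance I)) i ⟩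
      sumChains m k i (λ _ → ∣ i - j ∣ * chains m j) + sumChains m k i (λ I → sumChains m k j (distance I))
        ≡⟨ cong₂ _+_ (trans (sumChains-const m (∣ i - j ∣ * chains m j) i≤k)
                            (reorder ∣ i - j ∣ (chains m j) (chains m i)))
                     (sumChains-distance m i≤k j≤k) ⟩
      spread-summand m i j ∎
      where
      reorder : ∀ d p q → d * p * q ≡ d * (q * p)
      reorder = solve-∀

  sumOver-ideals : ∀ m k (f : Mat m k → ℕ) → sumOver (ideals m k) f ≡ sumChains m k k f
  sumOver-ideals m k f = trans (sumOver-filter isIdeal f (allMats m k))
    (sumOver-cong (λ I → cong (λ p → when p (f I)) (isIdeal≡chainᵇ I)) (allMats m k))

  spread-isWienerIndex : ∀ m k → WienerIndexIs m k (spread m k k)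
  spread-isWienerIndex m k = distance , distance-isDist , sym (begin
    sumℕ (concatMap (λ I → map (distance I) (ideals m k)) (ideals m k))
      ≡⟨ sumℕ-concatMap (λ I → map (distance I) (ideals m k)) (ideals m k) ⟩
    sumOver (ideals m k) (λ I → sumOver (ideals m k) (distance I))
      ≡⟨ sumOver-ideals m k _ ⟩
    sumChains m k k (λ I → sumOver (ideals m k) (distance I))
      ≡⟨ sumChains-cong (λ I → sumOver-ideals m k (distance I)) k ⟩
    sumChains m k k (λ I → sumChains m k k (distance I))
      ≡⟨ sumChains-distance m ≤-refl ≤-refl ⟩
    spread m k k ∎)
    where
    sumℕ-concatMap : ∀ {A : Set} (g : A → List ℕ) xs → sumℕ (concatMap g xs) ≡ sumOver xs (sumℕ ∘ g)
    sumℕ-concatMap g []       = refl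
    sumℕ-concatMap g (x ∷ xs) = trans (sum-++ (g x) (concatMap g xs)) (cong (_+_ (sumℕ (g x))) (sumℕ-concatMap g xs))

theorem1p2 : Σ (ℕ → ℕ → ℕ) λ w →
    ((m k : ℕ) → WienerIndexIs m k (w m k)) ×
    ((m k : ℕ) → conv denom (λ a b → + (w a b)) m k ≡ numer m k)
theorem1p2 = (λ m k → Counting.spread m k k) , WienerSum.spread-isWienerIndex , GeneratingFunction.spread-series
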